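{- Let $G$ be a triangulated plane graph and let $\alpha$ and $\beta$ be two internal faces of $G$ having exactly one edge in common. Let $C$ be the set of cycles consisting of the internal faces of $G$, with the cycle $\alpha$ replaced by the cycle $\alpha\,\Delta\,\beta$. Then $C$ cyclically spans the cycle space of $G$.
   Context: A triangulated plane graph is a plane graph all of whose faces are bounded by triangles; internal faces are the bounded faces. A face is identified with its boundary cycle and with the edge set of that cycle; cycles are identified with their edge sets and $\Delta$ denotes symmetric difference. A set of cycles $C$ of $G$ cyclically spans the cycle space of $G$ if for every cycle $\sigma$ of $G$ there are cycles $\alpha_1,\dots,\alpha_m\in C$ such that $\sigma=\alpha_1\Delta\alpha_2\Delta\cdots\Delta\alpha_m$ and, for each $i=2,\dots,m$, $\alpha_1\Delta\cdots\Delta\alpha_i$ is (the edge set of) a cycle of $G$. -}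

module Defs where

open import Data.Nat using (ℕ; zero; suc; _+_; _*_)
open import Data.Fin using (Fin; zero; suc; inject₁; fromℕ; _≟_)
open import Data.Bool using (Bool; true; false; _∨_; _xor_)
open import Data.List using (List; []; _∷_)
open import Data.List.Relation.Unary.All using (All)
open import Data.Product using (Σ; ∃; _×_; _,_)
open import Data.Sum using (_⊎_)
open import Relation.Nullary using (¬_)
open import Relation.Nullary.Decidable using (⌊_⌋)
open import Relation.Binary.PropositionalEquality using (_≡_; _≢_)
open import Function.Bundles using (_⇔_)

iter : ∀ {A : Set} → (A → A) → ℕ → A → A
iter f zero x = x
iter f (suc k) x = f (iter f k x)

walk : ∀ {A : Set} → (A → A) → (A → A) → A → List Bool → A
walk a f x [] = x
walk a f x (false ∷ w) = walk a f (a x) w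
walk a f x (true ∷ w) = walk a f (f x) w

-- A triangulated plane graph, encoded as a (connected, genus 0) combinatorial map.
-- Darts (= directed half-edges) are Fin d, vertices are Fin n.
--   vert x    : tail vertex of dart x
--   α x       : the reverse dart (same edge, opposite direction); head x = vert (α x)
--   φ x       : the next dart along the boundary of the face to which x belongs
--   σ = φ ∘ α : rotation of darts around their common tail vertex
-- Faces are the φ-orbits; edges are the α-orbits; vertices are the σ-orbits.
record TriangulatedPlaneGraph : Set where
  field
    n d   : ℕ
    vert  : Fin d → Fin n
    α     : Fin d → Fin d
    φ     : Fin d → Fin d
    α-invol  : ∀ x → α (α x) ≡ x
    α-nofix  : ∀ x → α x ≢ x
    φ-tri    : ∀ x → φ (φ (φ x)) ≡ x
    φ-nofix  : ∀ x → φ x ≢ x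
    φ-head   : ∀ x → vert (φ x) ≡ vert (α x)
    vert-orbit : ∀ x y → vert x ≡ vert y → ∃ λ k → iter (λ z → φ (α z)) k x ≡ y
    vert-surj  : ∀ v → ∃ λ x → vert x ≡ v
    connected : ∀ x y → ∃ λ (w : List Bool) → walk α φ x w ≡ y
    -- Euler's formula V − E + F = 2 with E = d/2, F = d/3 (genus 0, i.e. plane)
    euler : d + 12 ≡ 6 * n
    no-loop  : ∀ x → vert x ≢ vert (α x)
    no-multi : ∀ x y → vert x ≡ vert y → vert (α x) ≡ vert (α y) → x ≡ y
    -- a dart on the outer (unbounded) face
    outer : Fin d

module _ (G : TriangulatedPlaneGraph) where
  open TriangulatedPlaneGraph G

  -- edge sets: Boolean predicates on darts (intended α-invariant: an edge is {x , α x})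
  EdgeSet : Set
  EdgeSet = Fin d → Bool

  _≗E_ : EdgeSet → EdgeSet → Set
  S ≗E T = ∀ x → S x ≡ T x

  _Δ_ : EdgeSet → EdgeSet → EdgeSet
  (S Δ T) x = S x xor T x

  IsCycle : EdgeSet → Set
  IsCycle S = Σ ℕ λ m → Σ (Fin (suc (suc (suc m))) → Fin d) λ ds →
      (∀ (i : Fin (suc (suc m))) → vert (α (ds (inject₁ i))) ≡ vert (ds (suc i)))
    × vert (α (ds (fromℕ (suc (suc m))))) ≡ vert (ds zero)
    × (∀ i j → vert (ds i) ≡ vert (ds j) → i ≡ j)
    × (∀ y → (S y ≡ true) ⇔ (∃ λ i → y ≡ ds i ⊎ y ≡ α (ds i)))

  SameFace : Fin d → Fin d → Set
  SameFace x y = y ≡ x ⊎ y ≡ φ x ⊎ y ≡ φ (φ x)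

  Internal : Fin d → Set
  Internal x = ¬ SameFace outer x

  faceSet : Fin d → EdgeSet
  faceSet x y = ⌊ y ≟ x ⌋ ∨ ⌊ y ≟ φ x ⌋ ∨ ⌊ y ≟ φ (φ x) ⌋
              ∨ ⌊ y ≟ α x ⌋ ∨ ⌊ y ≟ α (φ x) ⌋ ∨ ⌊ y ≟ α (φ (φ x)) ⌋

  ExactlyOneCommonEdge : Fin d → Fin d → Set
  ExactlyOneCommonEdge a b = Σ (Fin d) λ y → faceSet a y ≡ true × faceSet b y ≡ true
    × (∀ z → faceSet a z ≡ true → faceSet b z ≡ true → z ≡ y ⊎ z ≡ α y)

  ReplacedFaces : Fin d → Fin d → EdgeSet → Set
  ReplacedFaces a b S = S ≗E (faceSet a Δ faceSet b)
    ⊎ Σ (Fin d) λ x → Internal x × ¬ SameFace a x × S ≗E faceSet x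

  GoodChain : EdgeSet → List EdgeSet → EdgeSet → Set
  GoodChain acc [] σ = acc ≗E σ
  GoodChain acc (c ∷ cs) σ = IsCycle (acc Δ c) × GoodChain (acc Δ c) cs σ

  CyclicallySpans : (EdgeSet → Set) → Set
  CyclicallySpans C = ∀ σ → IsCycle σ →
    Σ EdgeSet λ α₁ → Σ (List EdgeSet) λ rest → C α₁ × All C rest × GoodChain α₁ rest σ

{-# OPTIONS --safe #-}
-- Over the two-element field, Euler's formula forces every closed walk to be the boundary of a set of
-- faces not containing the outer one: faces, walk and spanning tree edges outnumber the edges, so they are
-- dependent. A cycle thus bounds a region I, and I can be shelled: if f is a face of I but not all of I,
-- then some face of I other than f can be removed so that the boundary remains a cycle. Read
-- backwards this is a chain of cycles from f to the given cycle which adds each remaining face of I once.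
-- If a lies in I, take f = a, the cycle a being obtained as (a Δ b) Δ b; otherwise any f in I will do.
module Submission where

open import Defs
open import Data.Fin using (Fin)
open import Algebra.Bundles using (CommutativeRing)
open import Data.Bool as Bool using (Bool; true; false; not; _∧_; _∨_; _xor_; if_then_else_)
open import Data.Bool.Properties using (xor-identityʳ; xor-same; ∧-zeroʳ; ∧-identityʳ; xor-comm; xor-∧-commutativeRing; ∧-distribˡ-xor)
open import Data.Bool.Solver using (module xor-∧-Solver)
open import Data.Empty using (⊥; ⊥-elim)
open import Data.Fin as Fin using (zero; suc; inject₁; fromℕ; _≟_; _<?_)
open import Data.Fin.Permutation using (Permutation′; permutation)
import Data.Fin.Properties as Fin
open import Data.List as List using (List; []; _∷_; _++_; length; allFin; filter)
open import Data.List.Membership.Propositional using (_∈_; _∉_; find)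
open import Data.List.Membership.Propositional.Properties using (∈-map⁺; ∈-map⁻; ∈-++⁺ˡ; ∈-++⁻; ∈-∃++; ∈-filter⁺; ∈-allFin; ∈-lookup; ∈-tabulate⁺; ∈-tabulate⁻)
open import Data.List.Properties using (length-++; length-map; map-++; ++-assoc; map-tabulate; length-tabulate)
open import Data.List.Relation.Binary.Permutation.Propositional using (_↭_; ↭⇒↭ₛ)
open import Data.List.Relation.Binary.Permutation.Propositional.Properties using (++-comm; ↭-length)
import Data.List.Relation.Binary.Permutation.Setoid.Properties as Permutation
open import Data.List.Relation.Unary.All as All using (All; []; _∷_)
import Data.List.Relation.Unary.All.Properties as All
open import Data.List.Relation.Unary.AllPairs as AllPairs using (AllPairs; []; _∷_)
open import Data.List.Relation.Unary.Any as Any using (here; there; any?)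
import Data.List.Relation.Unary.Any.Properties as Any
open import Data.List.Relation.Unary.Unique.Propositional using (Unique)
import Data.List.Relation.Unary.Unique.Propositional.Properties as Unique
open import Data.Nat as ℕ using (ℕ; zero; suc; s≤s)
import Data.Nat.Properties as ℕ
import Data.Nat.Solver as ℕSolver
open import Data.Product using (Σ; ∃; ∃₂; _×_; _,_; proj₁; proj₂)
open import Data.Sum using (_⊎_; inj₁; inj₂)
open import Data.Vec as Vec using (Vec; []; _∷_)
import Data.Vec.Properties as Vec
open import Function using (_∘_; id)
open import Function.Bundles using (mk⇔; Equivalence)
open import Relation.Binary.Definitions using (tri<; tri≈; tri>)
open import Relation.Binary.PropositionalEquality hiding (J)
open import Relation.Nullary using (¬_; Dec; yes; no)
open import Relation.Nullary.Decidable using (⌊_⌋; ¬?; _×-dec_)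
open import Algebra.Properties.CommutativeMonoid.Sum (CommutativeRing.+-commutativeMonoid xor-∧-commutativeRing) using (sum; sum-cong-≗; ∑-distrib-+; sum-permute)
import Algebra.Properties.CommutativeMonoid.Sum ℕ.+-0-commutativeMonoid as ℕΣ
open xor-∧-Solver using (solve; _:+_; _:*_; _:=_; con)

-- The face `a` has to come first because it costs two summands: in the middle of a chain, adding
-- `a Δ b` could destroy the cycle, whereas at the start the sum simply passes from `a Δ b` to the
-- triangle `a`. Hence the shelling must spare a prescribed face, and this is the real difficulty.
-- Removing a face leaves a single cycle if it has one edge on the cycle and its third vertex off
-- it, or if it has two edges on a cycle that is longer than a triangle. A face with an edge on the
-- cycle can fail both tests; then its third vertex lies on the cycle and one of its sides is a
-- chord that cuts off a shorter subpath, along which the search goes on. Only faces with an edge on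
-- the current subpath are ever removed, so `f` is safe as soon as that subpath has no edge of `f`,
-- wherever `f` itself lies. There is such a subpath to begin with: all but one edge of the cycle if
-- `f` has no edge on it, and otherwise one that is closed by a side of `f`.

true≢false : ∀ {b} → b ≡ true → b ≡ false → ⊥
true≢false refl ()

≢true⇒false : ∀ {b} → (b ≡ true → ⊥) → b ≡ false
≢true⇒false {false} _ = refl
≢true⇒false {true} h = ⊥-elim (h refl)

≢false⇒true : ∀ {b} → b ≢ false → b ≡ true
≢false⇒true {false} h = ⊥-elim (h refl)
≢false⇒true {true} _ = refl

≡-from-true : ∀ {a b} → (a ≡ true → b ≡ true) → (b ≡ true → a ≡ true) → a ≡ b
≡-from-true {false} {false} _ _ = refl
≡-from-true {false} {true} _ g = g refl
≡-from-true {true} f _ = sym (f refl)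

xor-false⇒≡ : ∀ {a b} → a xor b ≡ false → a ≡ b
xor-false⇒≡ {false} refl = refl
xor-false⇒≡ {true} {true} _ = refl

xor-true⇒ : ∀ a {b} → a xor b ≡ true → a ≡ true ⊎ b ≡ true
xor-true⇒ true _ = inj₁ refl
xor-true⇒ false h = inj₂ h

-- Linear algebra over the two-element field

dot : ∀ {m} → Vec Bool m → Vec Bool m → Bool
dot [] [] = false
dot (x ∷ xs) (y ∷ ys) = (x ∧ y) xor dot xs ys

zeros : ∀ m → Vec Bool m
zeros m = Vec.replicate m false

zeros-++ : ∀ k l → zeros k Vec.++ zeros l ≡ zeros (k ℕ.+ l)
zeros-++ zero l = refl
zeros-++ (suc k) l = cong (false ∷_) (zeros-++ k l)

dot-zerosˡ : ∀ {m} (c : Vec Bool m) → dot (zeros m) c ≡ false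
dot-zerosˡ [] = refl
dot-zerosˡ (_ ∷ c) = dot-zerosˡ c

dot-zerosʳ : ∀ {m} (r : Vec Bool m) → dot r (zeros m) ≡ false
dot-zerosʳ [] = refl
dot-zerosʳ (x ∷ r) rewrite ∧-zeroʳ x = dot-zerosʳ r

dot-++ : ∀ {m k} (r c : Vec Bool m) (s e : Vec Bool k) →
  dot (r Vec.++ s) (c Vec.++ e) ≡ dot r c xor dot s e
dot-++ [] [] s e = refl
dot-++ (x ∷ r) (y ∷ c) s e rewrite dot-++ r c s e =
  solve 3 (λ a b c → a :+ (b :+ c) := (a :+ b) :+ c) refl (x ∧ y) (dot r c) (dot s e)

dot-map-xor : ∀ {A : Set} {m} (f g : A → Bool) (xs : Vec A m) (c : Vec Bool m) →
  dot (Vec.map (λ x → f x xor g x) xs) c ≡ dot (Vec.map f xs) c xor dot (Vec.map g xs) c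
dot-map-xor f g [] [] = refl
dot-map-xor f g (x ∷ xs) (y ∷ c) rewrite dot-map-xor f g xs c =
  solve 5 (λ a b y u v → (a :+ b) :* y :+ (u :+ v) := (a :* y :+ u) :+ (b :* y :+ v))
    refl (f x) (g x) y (dot (Vec.map f xs) c) (dot (Vec.map g xs) c)

dot-zipWith-xor : ∀ {m} (r s c : Vec Bool m) → dot (Vec.zipWith _xor_ r s) c ≡ dot r c xor dot s c
dot-zipWith-xor [] [] [] = refl
dot-zipWith-xor (a ∷ r) (b ∷ s) (y ∷ c) rewrite dot-zipWith-xor r s c =
  solve 5 (λ a b y u v → (a :+ b) :* y :+ (u :+ v) := (a :* y :+ u) :+ (b :* y :+ v))
    refl a b y (dot r c) (dot s c)

private
  Row : ℕ → Set
  Row m = Vec Bool (suc m)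

  pivot : ∀ {m} (rows : List (Row m)) →
    All (λ r → Vec.head r ≡ false) rows ⊎
    ∃ λ pre → ∃₂ λ r post → rows ≡ pre ++ (true ∷ r) ∷ post
  pivot [] = inj₁ []
  pivot ((true ∷ r) ∷ rows) = inj₂ ([] , r , rows , refl)
  pivot ((false ∷ r) ∷ rows) with pivot rows
  ... | inj₁ h = inj₁ (refl ∷ h)
  ... | inj₂ (pre , r′ , post , refl) = inj₂ (_ ∷ pre , r′ , post , refl)

  eliminate : ∀ {m} → Vec Bool m → Row m → Vec Bool m
  eliminate r (false ∷ s) = s
  eliminate r (true ∷ s) = Vec.zipWith _xor_ s r

  -- Back substitution: the pivot row `true ∷ r` forces the value `dot r c` on the eliminated
  -- unknown.
  eliminate-sound : ∀ {m} (r : Vec Bool m) (s : Row m) (c : Vec Bool m) →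
    dot (eliminate r s) c ≡ false → dot s (dot r c ∷ c) ≡ false
  eliminate-sound r (false ∷ s) c h = h
  eliminate-sound r (true ∷ s) c h =
    trans (trans (xor-comm (dot r c) (dot s c)) (sym (dot-zipWith-xor s r c))) h

-- Gaussian elimination by induction on the number of unknowns: a pivot uses up one row and one
-- unknown, so the rows remain fewer than the unknowns.
nontrivial-solution : ∀ {m} (rows : List (Vec Bool m)) → length rows ℕ.< m →
  ∃ λ c → c ≢ zeros m × All (λ r → dot r c ≡ false) rows
nontrivial-solution {suc m} rows len<m with pivot rows
-- Without a pivot the first unknown occurs in no equation, so the first unit vector is a solution.
... | inj₁ h = true ∷ zeros m , (λ ()) , All.map (λ {r} → vanishes r) h
  where
  vanishes : (r : Row m) → Vec.head r ≡ false → dot r (true ∷ zeros m) ≡ false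
  vanishes (false ∷ r) refl = dot-zerosʳ r
... | inj₂ (pre , r , post , refl) = extend (nontrivial-solution rest rest<m)
  where
  rest : List (Vec Bool m)
  rest = List.map (eliminate r) (pre ++ post)
  rest<m : length rest ℕ.< m
  rest<m = ℕ.≤-pred (subst (ℕ._< suc m) (begin
    length (pre ++ (true ∷ r) ∷ post)      ≡⟨ length-++ pre ⟩
    length pre ℕ.+ suc (length post)       ≡⟨ ℕ.+-suc _ _ ⟩
    suc (length pre ℕ.+ length post)       ≡⟨ cong suc (length-++ pre) ⟨
    suc (length (pre ++ post))             ≡⟨ cong suc (length-map _ (pre ++ post)) ⟨
    suc (length rest)                      ∎) len<m)
    where open ≡-Reasoning
  extend : (∃ λ c → c ≢ zeros m × All (λ s → dot s c ≡ false) rest) →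
    ∃ λ c → c ≢ zeros (suc m) × All (λ s → dot s c ≡ false) (pre ++ (true ∷ r) ∷ post)
  extend (c , c≢0 , sol) = dot r c ∷ c , c≢0 ∘ cong Vec.tail ,
    All.++⁺ (All.++⁻ˡ pre sol′) (xor-same (dot r c) ∷ All.++⁻ʳ pre sol′)
    where
    sol′ : All (λ s → dot s (dot r c ∷ c) ≡ false) (pre ++ post)
    sol′ = All.map (λ {s} → eliminate-sound r s c) (All.map⁻ sol)

-- Kronecker deltas and sums over the two-element field

δ : ∀ {k} → Fin k → Fin k → Bool
δ x y = ⌊ x ≟ y ⌋

δ-refl : ∀ {k} (x : Fin k) → δ x x ≡ true
δ-refl x with x ≟ x
... | yes _ = refl
... | no x≢x = ⊥-elim (x≢x refl)

δ-≡ : ∀ {k} {x y : Fin k} → x ≡ y → δ x y ≡ true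
δ-≡ refl = δ-refl _

δ-≢ : ∀ {k} {x y : Fin k} → x ≢ y → δ x y ≡ false
δ-≢ {x = x} {y} x≢y with x ≟ y
... | yes x≡y = ⊥-elim (x≢y x≡y)
... | no _ = refl

δ-true : ∀ {k} {x y : Fin k} → δ x y ≡ true → x ≡ y
δ-true {x = x} {y} h with x ≟ y
... | yes x≡y = x≡y

δ-cong-⇔ : ∀ {k l} {x y : Fin k} {z w : Fin l} →
  (x ≡ y → z ≡ w) → (z ≡ w → x ≡ y) → δ x y ≡ δ z w
δ-cong-⇔ f g = ≡-from-true (δ-≡ ∘ f ∘ δ-true) (δ-≡ ∘ g ∘ δ-true)

sum-false : ∀ {k} (f : Fin k → Bool) → (∀ x → f x ≡ false) → sum f ≡ false
sum-false {zero} f h = refl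
sum-false {suc k} f h rewrite h zero = sum-false (f ∘ suc) (h ∘ suc)

sum-single : ∀ {k} (f : Fin k → Bool) y → (∀ x → x ≢ y → f x ≡ false) → sum f ≡ f y
sum-single f zero h rewrite sum-false (f ∘ suc) (λ x → h (suc x) (λ ())) = xor-identityʳ (f zero)
sum-single f (suc y) h rewrite h zero (λ ()) =
  sum-single (f ∘ suc) y (λ x x≢y → h (suc x) (x≢y ∘ Fin.suc-injective))

-- Counting representatives of orbits

bit : Bool → ℕ
bit b = if b then 1 else 0

count : ∀ {k} → (Fin k → Bool) → ℕ
count p = ℕΣ.sum (bit ∘ p)

bit-mono : ∀ {a b} → (a ≡ true → b ≡ true) → bit a ℕ.≤ bit b
bit-mono {false} f = ℕ.z≤n
bit-mono {true} f rewrite f refl = ℕ.≤-refl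

count-≤ : ∀ {k} (p q : Fin k → Bool) → (∀ x → p x ≡ true → q x ≡ true) → count p ℕ.≤ count q
count-≤ {zero} p q h = ℕ.z≤n
count-≤ {suc k} p q h = ℕ.+-mono-≤ (bit-mono (h zero)) (count-≤ _ _ (h ∘ suc))

count-< : ∀ {k} (p q : Fin k → Bool) → (∀ x → p x ≡ true → q x ≡ true) →
  ∀ y → p y ≡ false → q y ≡ true → count p ℕ.< count q
count-< {suc k} p q p⊆q zero py qy rewrite py | qy = s≤s (count-≤ _ _ (p⊆q ∘ suc))
count-< {suc k} p q p⊆q (suc y) py qy =
  ℕ.+-mono-≤-< (bit-mono (p⊆q zero)) (count-< _ _ (p⊆q ∘ suc) y py qy)

filterTrue : ∀ {k} → (Fin k → Bool) → List (Fin k)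
filterTrue p = filter (λ x → p x Bool.≟ true) (allFin _)

length-filterTrue : ∀ {k} (p : Fin k → Bool) → length (filterTrue p) ≡ count p
length-filterTrue p = go id
  where
  go : ∀ {l} (f : Fin l → Fin _) →
    length (filter (λ x → p x Bool.≟ true) (List.tabulate f)) ≡ count (p ∘ f)
  go {zero} f = refl
  go {suc l} f with p (f zero)
  ... | false = go (f ∘ suc)
  ... | true = cong suc (go (f ∘ suc))

sum-ones : ∀ k → ℕΣ.sum {k} (λ _ → 1) ≡ k
sum-ones zero = refl
sum-ones (suc k) = cong suc (sum-ones k)

count-permute : ∀ {k} (p : Fin k → Bool) (f g : Fin k → Fin k) →
  (∀ x → f (g x) ≡ x) → (∀ x → g (f x) ≡ x) → count (p ∘ f) ≡ count p
count-permute p f g fg gf = sym (ℕΣ.sum-permute (bit ∘ p) (permutation f g fg gf))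

module _ {k} (α : Fin k → Fin k) (α-invol : ∀ x → α (α x) ≡ x) (α-nofix : ∀ x → α x ≢ x) where

  rep₂ : Fin k → Bool
  rep₂ x = ⌊ x <? α x ⌋

  rep₂-bits : ∀ x → bit (rep₂ x) ℕ.+ bit (rep₂ (α x)) ≡ 1
  rep₂-bits x rewrite α-invol x with x <? α x | α x <? x
  ... | yes p | yes q = ⊥-elim (Fin.<-asym p q)
  ... | yes p | no q = refl
  ... | no p | yes q = refl
  ... | no p | no q with Fin.<-cmp x (α x)
  ...   | tri< h _ _ = ⊥-elim (p h)
  ...   | tri≈ _ h _ = ⊥-elim (α-nofix x (sym h))
  ...   | tri> _ _ h = ⊥-elim (q h)

  rep₂-total : ∀ x → rep₂ x ≡ true ⊎ rep₂ (α x) ≡ true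
  rep₂-total x with rep₂ x | rep₂ (α x) | rep₂-bits x
  ... | true | _ | _ = inj₁ refl
  ... | false | true | _ = inj₂ refl

  -- Summing `rep₂-bits` over all darts counts every representative twice, since `α` permutes the
  -- darts.
  rep₂-count : 2 ℕ.* length (filterTrue rep₂) ≡ k
  rep₂-count = begin
    2 ℕ.* length (filterTrue rep₂)          ≡⟨ cong (2 ℕ.*_) (length-filterTrue rep₂) ⟩
    c ℕ.+ (c ℕ.+ 0)                         ≡⟨ cong (c ℕ.+_) (ℕ.+-identityʳ c) ⟩
    c ℕ.+ c                                 ≡⟨ cong (c ℕ.+_) (count-permute rep₂ α α α-invol α-invol) ⟨
    c ℕ.+ count (rep₂ ∘ α)                  ≡⟨ ℕΣ.∑-distrib-+ (bit ∘ rep₂) (bit ∘ rep₂ ∘ α) ⟨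
    ℕΣ.sum (λ x → bit (rep₂ x) ℕ.+ bit (rep₂ (α x))) ≡⟨ ℕΣ.sum-cong-≗ rep₂-bits ⟩
    ℕΣ.sum {k} (λ _ → 1)                    ≡⟨ sum-ones k ⟩
    k                                       ∎
    where
    open ≡-Reasoning
    c = count rep₂

module _ {k} (φ : Fin k → Fin k) (φ-tri : ∀ x → φ (φ (φ x)) ≡ x) (φ-nofix : ∀ x → φ x ≢ x) where

  φ²-nofix : ∀ x → φ (φ x) ≢ x
  φ²-nofix x h = φ-nofix x (trans (cong φ (sym h)) (φ-tri x))

  rep₃ : Fin k → Bool
  rep₃ x = ⌊ x <? φ x ⌋ ∧ ⌊ x <? φ (φ x) ⌋

  private
    flip-< : ∀ {x y : Fin k} → x ≢ y → ⌊ y <? x ⌋ ≡ not ⌊ x <? y ⌋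
    flip-< {x} {y} x≢y with x <? y | y <? x
    ... | yes p | yes q = ⊥-elim (Fin.<-asym p q)
    ... | yes p | no q = refl
    ... | no p | yes q = refl
    ... | no p | no q with Fin.<-cmp x y
    ...   | tri< h _ _ = ⊥-elim (p h)
    ...   | tri≈ _ h _ = ⊥-elim (x≢y h)
    ...   | tri> _ _ h = ⊥-elim (q h)

  rep₃-bits : ∀ x → bit (rep₃ x) ℕ.+ (bit (rep₃ (φ x)) ℕ.+ bit (rep₃ (φ (φ x)))) ≡ 1
  rep₃-bits x
    -- All comparisons are reduced to the three along the cyclic order `x`, `φ x`, `φ (φ x)`. Only
    -- the two cases in which all three hold or all three fail contradict transitivity; in each of
    -- the others there is one minimum.
    rewrite φ-tri x
          | flip-< {φ (φ x)} {x} (φ²-nofix x)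
          | flip-< {x} {φ x} (φ-nofix x ∘ sym)
          | flip-< {φ x} {φ (φ x)} (φ-nofix (φ x) ∘ sym)
    with x <? φ x | φ x <? φ (φ x) | φ (φ x) <? x
  ... | yes p | yes q | yes r = ⊥-elim (Fin.<-asym (Fin.<-trans p q) r)
  ... | yes p | yes q | no r = refl
  ... | yes p | no q | yes r = refl
  ... | yes p | no q | no r = refl
  ... | no p | yes q | yes r = refl
  ... | no p | yes q | no r = refl
  ... | no p | no q | yes r = refl
  ... | no p | no q | no r = ⊥-elim (Fin.<-asym
    (Fin.≤∧≢⇒< (ℕ.≤-trans (ℕ.≮⇒≥ q) (ℕ.≮⇒≥ p)) (φ²-nofix x)) (Fin.≤∧≢⇒< (ℕ.≮⇒≥ r) (φ²-nofix x ∘ sym)))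

  rep₃-count : 3 ℕ.* length (filterTrue rep₃) ≡ k
  rep₃-count = begin
    3 ℕ.* length (filterTrue rep₃)          ≡⟨ cong (3 ℕ.*_) (length-filterTrue rep₃) ⟩
    c ℕ.+ (c ℕ.+ (c ℕ.+ 0))                 ≡⟨ cong (λ z → c ℕ.+ (c ℕ.+ z)) (ℕ.+-identityʳ c) ⟩
    c ℕ.+ (c ℕ.+ c)                         ≡⟨ cong₂ (λ y z → c ℕ.+ (y ℕ.+ z))
                                                 (count-permute rep₃ φ (φ ∘ φ) φ-tri φ-tri)
                                                 (count-permute rep₃ (φ ∘ φ) φ φ-tri φ-tri) ⟨
    c ℕ.+ (count (rep₃ ∘ φ) ℕ.+ count (rep₃ ∘ φ ∘ φ))
      ≡⟨ cong (c ℕ.+_) (ℕΣ.∑-distrib-+ (bit ∘ rep₃ ∘ φ) (bit ∘ rep₃ ∘ φ ∘ φ)) ⟨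
    c ℕ.+ ℕΣ.sum (λ x → bit (rep₃ (φ x)) ℕ.+ bit (rep₃ (φ (φ x))))
      ≡⟨ ℕΣ.∑-distrib-+ (bit ∘ rep₃) (λ x → bit (rep₃ (φ x)) ℕ.+ bit (rep₃ (φ (φ x)))) ⟨
    ℕΣ.sum (λ x → bit (rep₃ x) ℕ.+ (bit (rep₃ (φ x)) ℕ.+ bit (rep₃ (φ (φ x))))) ≡⟨ ℕΣ.sum-cong-≗ rep₃-bits ⟩
    ℕΣ.sum {k} (λ _ → 1)                    ≡⟨ sum-ones k ⟩
    k                                       ∎
    where
    open ≡-Reasoning
    c = count rep₃

  rep₃-unique : ∀ {x y} → rep₃ x ≡ true → rep₃ y ≡ true →
    y ≡ x ⊎ y ≡ φ x ⊎ y ≡ φ (φ x) → x ≡ y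
  rep₃-unique p q (inj₁ refl) = refl
  rep₃-unique {x} p q (inj₂ (inj₁ refl)) with rep₃ x | rep₃ (φ x) | rep₃ (φ (φ x)) | rep₃-bits x
  rep₃-unique refl refl (inj₂ (inj₁ refl)) | true | true | false | ()
  rep₃-unique refl refl (inj₂ (inj₁ refl)) | true | true | true | ()
  rep₃-unique {x} p q (inj₂ (inj₂ refl)) with rep₃ x | rep₃ (φ x) | rep₃ (φ (φ x)) | rep₃-bits x
  rep₃-unique refl refl (inj₂ (inj₂ refl)) | true | true | true | ()
  rep₃-unique refl refl (inj₂ (inj₂ refl)) | true | false | true | ()

-- Identities for exclusive or, and lists without repetition

xor-telescope : ∀ a b c → (a xor b) xor (b xor c) ≡ a xor c
xor-telescope = solve 3 (λ a b c → (a :+ b) :+ (b :+ c) := a :+ c) refl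

xor-rotate : ∀ a b c → c xor (a xor b) ≡ a xor (b xor c)
xor-rotate = solve 3 (λ a b c → c :+ (a :+ b) := a :+ (b :+ c)) refl

xor-zip₃ : ∀ a b c d e f →
  (a xor (b xor c)) xor (d xor (e xor f)) ≡ (a xor d) xor ((b xor e) xor ((c xor f) xor false))
xor-zip₃ = solve 6 (λ a b c d e f → (a :+ (b :+ c)) :+ (d :+ (e :+ f)) :=
                                    (a :+ d) :+ ((b :+ e) :+ ((c :+ f) :+ con false))) refl

xor-cancelʳ : ∀ a b → (a xor b) xor b ≡ a
xor-cancelʳ = solve 2 (λ a b → (a :+ b) :+ b := a) refl

∨-true : ∀ a {b} → a ∨ b ≡ true → a ≡ true ⊎ b ≡ true
∨-true true _ = inj₁ refl
∨-true false h = inj₂ h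

∨-trueˡ : ∀ {a} b → a ≡ true → a ∨ b ≡ true
∨-trueˡ b refl = refl

∨-trueʳ : ∀ a {b} → b ≡ true → a ∨ b ≡ true
∨-trueʳ false h = h
∨-trueʳ true h = refl

Unique-map⇒injective : ∀ {A B : Set} {f : A → B} {xs} → Unique (List.map f xs) →
  ∀ {x y} → x ∈ xs → y ∈ xs → f x ≡ f y → x ≡ y
Unique-map⇒injective (_ ∷ _) (here refl) (here refl) _ = refl
Unique-map⇒injective (p ∷ _) (here refl) (there y∈) eq = ⊥-elim (All.lookup p (∈-map⁺ _ y∈) eq)
Unique-map⇒injective (p ∷ _) (there x∈) (here refl) eq = ⊥-elim (All.lookup p (∈-map⁺ _ x∈) (sym eq))
Unique-map⇒injective (_ ∷ u) (there x∈) (there y∈) eq = Unique-map⇒injective u x∈ y∈ eq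

Unique-map-++ʳ : ∀ {A B : Set} {f : A → B} xs {ys} → Unique (List.map f (xs ++ ys)) → Unique (List.map f ys)
Unique-map-++ʳ [] u = u
Unique-map-++ʳ (x ∷ xs) (_ ∷ u) = Unique-map-++ʳ xs u

Unique-resp-↭ : ∀ {A : Set} {xs ys : List A} → xs ↭ ys → Unique xs → Unique ys
Unique-resp-↭ {A} p = Permutation.Unique-resp-↭ (setoid A) (↭⇒↭ₛ p)

∧-not-absorbs : ∀ a b → a ∧ not b ≡ b → b ≡ false
∧-not-absorbs a false _ = refl
∧-not-absorbs false true ()
∧-not-absorbs true true ()

-- Here `a`, `a′` and `b`, `b′` tell on which sides of an edge two sets of faces lie. If the edge is
-- not on the boundary of the second set, it can bound the difference only outside that set, where
-- the difference is the first set.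
∖-boundary : ∀ a a′ b {b′} → b ≡ b′ → (a ∧ not b) xor (a′ ∧ not b′) ≡ true → b ≡ false × a xor a′ ≡ true
∖-boundary true false false refl h = refl , refl
∖-boundary false true false refl h = refl , refl
∖-boundary true true false refl ()
∖-boundary false false false refl ()
∖-boundary false false true refl ()
∖-boundary false true true refl ()
∖-boundary true false true refl ()
∖-boundary true true true refl ()

module Plane (G : TriangulatedPlaneGraph) where
  open TriangulatedPlaneGraph G

  Dart : Set
  Dart = Fin d

  hd : Dart → Fin n
  hd x = vert (α x)

  hd-α : ∀ x → hd (α x) ≡ vert x
  hd-α x = cong vert (α-invol x)

  -- Degrees modulo 2

  -- A set of faces is encoded as a `φ`-invariant set of darts. The two darts of an edge stand for
  -- its two sides, so this is the boundary modulo 2.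
  ∂ : (Dart → Bool) → Dart → Bool
  ∂ I y = I y xor I (α y)

  φ-Invariant : (Dart → Bool) → Set
  φ-Invariant I = ∀ x → I (φ x) ≡ I x

  edge : Dart → Dart → Bool
  edge x y = δ y x xor δ y (α x)

  -- The list read as a chain over the two-element field: edges traversed an even number of times
  -- cancel.
  edgeSum : List Dart → Dart → Bool
  edgeSum [] y = false
  edgeSum (x ∷ L) y = edge x y xor edgeSum L y

  δ-α : ∀ x y → δ (α y) x ≡ δ y (α x)
  δ-α x y = δ-cong-⇔ (λ { refl → sym (α-invol y) }) (λ { refl → α-invol x })

  δ-αα : ∀ x y → δ (α y) (α x) ≡ δ y x
  δ-αα x y = trans (δ-α (α x) y) (cong (δ y) (α-invol x))

  edge-αʳ : ∀ x y → edge x (α y) ≡ edge x y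
  edge-αʳ x y rewrite δ-α x y | δ-αα x y = xor-comm (δ y (α x)) (δ y x)

  edge-αˡ : ∀ x y → edge (α x) y ≡ edge x y
  edge-αˡ x y rewrite α-invol x = xor-comm (δ y (α x)) (δ y x)

  edgeSum-αʳ : ∀ L y → edgeSum L (α y) ≡ edgeSum L y
  edgeSum-αʳ [] y = refl
  edgeSum-αʳ (x ∷ L) y = cong₂ _xor_ (edge-αʳ x y) (edgeSum-αʳ L y)

  ∂-α : ∀ I y → ∂ I (α y) ≡ ∂ I y
  ∂-α I y rewrite α-invol y = xor-comm (I (α y)) (I y)

  Path : Fin n → List Dart → Fin n → Set
  Path u [] w = u ≡ w
  Path u (x ∷ xs) w = vert x ≡ u × Path (hd x) xs w

  deg : Fin n → (Dart → Bool) → Bool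
  deg v S = sum (λ x → δ (vert x) v ∧ S x)

  deg-cong : ∀ v {S T} → (∀ x → S x ≡ T x) → deg v S ≡ deg v T
  deg-cong v h = sum-cong-≗ (λ x → cong (δ (vert x) v ∧_) (h x))

  deg-xor : ∀ v S T → deg v (λ x → S x xor T x) ≡ deg v S xor deg v T
  deg-xor v S T = trans (sum-cong-≗ (λ x → ∧-distribˡ-xor (δ (vert x) v) (S x) (T x)))
    (∑-distrib-+ (λ x → δ (vert x) v ∧ S x) (λ x → δ (vert x) v ∧ T x))

  deg-single : ∀ S y → (∀ z → z ≢ y → vert z ≡ vert y → S z ≡ false) → deg (vert y) S ≡ S y
  deg-single S y h = trans (sum-single _ y only) (cong (_∧ S y) (δ-refl (vert y)))
    where
    only : ∀ z → z ≢ y → δ (vert z) (vert y) ∧ S z ≡ false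
    only z z≢y with vert z ≟ vert y
    ... | yes p = h z z≢y p
    ... | no _ = refl

  deg-δ : ∀ v x → deg v (λ y → δ y x) ≡ δ (vert x) v
  deg-δ v x = trans (sum-single _ x (λ z z≢x → trans (cong (δ (vert z) v ∧_) (δ-≢ z≢x)) (∧-zeroʳ _)))
    (trans (cong (δ (vert x) v ∧_) (δ-refl x)) (∧-identityʳ _))

  incidence : Fin n → Dart → Bool
  incidence v x = δ (vert x) v xor δ (hd x) v

  deg-edge : ∀ v x → deg v (edge x) ≡ incidence v x
  deg-edge v x = trans (deg-xor v (λ y → δ y x) (λ y → δ y (α x))) (cong₂ _xor_ (deg-δ v x) (deg-δ v (α x)))

  deg-false : ∀ v → deg v (λ _ → false) ≡ false
  deg-false v = sum-false _ (λ x → ∧-zeroʳ (δ (vert x) v))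

  deg-path : ∀ v u L w → Path u L w → deg v (edgeSum L) ≡ δ u v xor δ w v
  deg-path v u [] .u refl = trans (deg-false v) (sym (xor-same (δ u v)))
  deg-path v .(vert x) (x ∷ L) w (refl , p)
    rewrite deg-xor v (edge x) (edgeSum L) | deg-edge v x | deg-path v (hd x) L w p =
    xor-telescope (δ (vert x) v) (δ (hd x) v) (δ w v)

  -- Rotating the darts around their tails permutes them, so both terms of ∂ contribute equally.
  deg-∂ : ∀ v I → φ-Invariant I → deg v (∂ I) ≡ false
  deg-∂ v I inv = begin
    deg v (∂ I)                             ≡⟨ sum-cong-≗ pointwise ⟩
    sum (λ x → h x xor h (φ (α x)))         ≡⟨ ∑-distrib-+ h (h ∘ φ ∘ α) ⟩
    sum h xor sum (h ∘ φ ∘ α)               ≡⟨ cong (sum h xor_) (sum-permute h rotation) ⟨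
    sum h xor sum h                         ≡⟨ xor-same (sum h) ⟩
    false                                   ∎
    where
    open ≡-Reasoning
    h : Dart → Bool
    h x = δ (vert x) v ∧ I x
    rotation : Permutation′ d
    rotation = permutation (φ ∘ α) (α ∘ φ ∘ φ)
      (λ x → trans (cong φ (α-invol (φ (φ x)))) (φ-tri x))
      (λ x → trans (cong α (φ-tri (α x))) (α-invol x))
    pointwise : ∀ x → δ (vert x) v ∧ ∂ I x ≡ h x xor h (φ (α x))
    pointwise x rewrite inv (α x) | trans (φ-head (α x)) (hd-α x) =
      ∧-distribˡ-xor (δ (vert x) v) (I x) (I (α x))

  -- Faces

  face : Dart → Dart → Bool
  face t y = δ y t xor (δ y (φ t) xor δ y (φ (φ t)))

  φ-injective : ∀ {x y} → φ x ≡ φ y → x ≡ y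
  φ-injective {x} {y} h = trans (sym (φ-tri x)) (trans (cong (φ ∘ φ) h) (φ-tri y))

  face-φ : ∀ t → φ-Invariant (face t)
  face-φ t x
    rewrite δ-cong-⇔ {x = φ x} {φ t} {x} {t} φ-injective (cong φ)
          | δ-cong-⇔ {x = φ x} {φ (φ t)} {x} {φ t} φ-injective (cong φ)
          | δ-cong-⇔ {x = φ x} {t} {x} {φ (φ t)}
              (λ { refl → sym (φ-tri x) }) (λ { refl → φ-tri t }) =
    xor-rotate (δ x t) (δ x (φ t)) (δ x (φ (φ t)))

  face-self : ∀ t → face t t ≡ true
  face-self t rewrite δ-refl t | δ-≢ {x = t} {φ t} (φ-nofix t ∘ sym)
    | δ-≢ {x = t} {φ (φ t)} (φ²-nofix φ φ-tri φ-nofix t ∘ sym) = refl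

  face⇒SameFace : ∀ {t x} → face t x ≡ true → SameFace G t x
  face⇒SameFace {t} {x} h with x ≟ t | x ≟ φ t | x ≟ φ (φ t)
  ... | yes p | _ | _ = inj₁ p
  ... | no _ | yes p | _ = inj₂ (inj₁ p)
  ... | no _ | no _ | yes p = inj₂ (inj₂ p)
  face⇒SameFace () | no _ | no _ | no _

  triangle : Dart → List Dart
  triangle t = t ∷ φ t ∷ φ (φ t) ∷ []

  ∂-face : ∀ t y → ∂ (face t) y ≡ edgeSum (triangle t) y
  ∂-face t y rewrite δ-α t y | δ-α (φ t) y | δ-α (φ (φ t)) y =
    xor-zip₃ (δ y t) (δ y (φ t)) (δ y (φ (φ t))) (δ y (α t)) (δ y (α (φ t))) (δ y (α (φ (φ t))))

  SameFace-inv : ∀ {I} → φ-Invariant I → ∀ {x y} → SameFace G x y → I y ≡ I x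
  SameFace-inv inv (inj₁ refl) = refl
  SameFace-inv inv (inj₂ (inj₁ refl)) = inv _
  SameFace-inv inv (inj₂ (inj₂ refl)) = trans (inv _) (inv _)

  SameFace-sym : ∀ {x y} → SameFace G x y → SameFace G y x
  SameFace-sym (inj₁ refl) = inj₁ refl
  SameFace-sym {x} (inj₂ (inj₁ refl)) = inj₂ (inj₂ (sym (φ-tri x)))
  SameFace-sym {x} (inj₂ (inj₂ refl)) = inj₂ (inj₁ (sym (φ-tri x)))

  walk-inv : ∀ I → φ-Invariant I → (∀ y → ∂ I y ≡ false) → ∀ x w → I (walk α φ x w) ≡ I x
  walk-inv I inv h x [] = refl
  walk-inv I inv h x (false ∷ w) = trans (walk-inv I inv h (α x) w) (sym (xor-false⇒≡ (h x)))
  walk-inv I inv h x (true ∷ w) = trans (walk-inv I inv h (φ x) w) (inv x)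

  -- An empty boundary makes membership invariant under `α` as well as `φ`, so it is constant by
  -- connectedness, and the outer face decides its value.
  ∂-injective : ∀ I → φ-Invariant I → (∀ y → ∂ I y ≡ false) → I outer ≡ false → ∀ x → I x ≡ false
  ∂-injective I inv h out x with connected outer x
  ... | w , refl = trans (walk-inv I inv h outer w) out

  -- Spanning trees

  treeVerts : Fin n → List Dart → List (Fin n)
  treeVerts r ts = r ∷ List.map hd ts

  data Tree (r : Fin n) : List Dart → Set where
    root : Tree r []
    grow : ∀ {x ts} → Tree r ts → vert x ∈ treeVerts r ts → hd x ∉ treeVerts r ts → Tree r (x ∷ ts)

  weaken-treeVerts : ∀ {r x ts v} → v ∈ treeVerts r ts → v ∈ treeVerts r (x ∷ ts)
  weaken-treeVerts (here p) = here p
  weaken-treeVerts (there p) = there (there p)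

  tree-ends : ∀ {r ts} → Tree r ts →
    All (λ x → vert x ∈ treeVerts r ts × hd x ∈ treeVerts r ts) ts
  tree-ends root = []
  tree-ends (grow t p _) = (weaken-treeVerts p , there (here refl)) ∷
    All.map (λ (q , q′) → weaken-treeVerts q , weaken-treeVerts q′) (tree-ends t)

  open import Data.List.Membership.DecPropositional (Fin._≟_ {n}) using (_∈?_)

  Spanning : Fin n → List Dart → Set
  Spanning r ts = ∀ v → v ∈ treeVerts r ts

  closed⇒spanning : ∀ r ts → (∃ λ x → vert x ≡ r) →
    (∀ x → vert x ∈ treeVerts r ts → hd x ∈ treeVerts r ts) → Spanning r ts
  closed⇒spanning r ts (x₀ , refl) closed v with vert-surj v
  ... | x , refl with connected x₀ x
  ...   | w , refl = along x₀ (here refl) w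
    where
    along : ∀ x → vert x ∈ treeVerts (vert x₀) ts → ∀ w → vert (walk α φ x w) ∈ treeVerts (vert x₀) ts
    along x p [] = p
    along x p (false ∷ w) = along (α x) (closed x p) w
    along x p (true ∷ w) = along (φ x) (subst (_∈ treeVerts (vert x₀) ts) (sym (φ-head x)) (closed x p)) w

  spanning⇒≤ : ∀ {r ts} → Spanning r ts → n ℕ.≤ suc (length ts)
  spanning⇒≤ {r} {ts} span = subst (n ℕ.≤_) (cong suc (length-map hd ts))
    (Fin.injective⇒≤ {f = λ v → Any.index (span v)} injective)
    where
    injective : ∀ {v w} → Any.index (span v) ≡ Any.index (span w) → v ≡ w
    injective {v} {w} h = trans (Any.lookup-index (span v))
      (trans (cong (List.lookup (treeVerts r ts)) h) (sym (Any.lookup-index (span w))))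

  growTree : ∀ r → (∃ λ x → vert x ≡ r) → ∀ k → ∃ λ ts → Tree r ts × (k ℕ.≤ length ts ⊎ Spanning r ts)
  growTree r r-tail zero = [] , root , inj₁ ℕ.z≤n
  growTree r r-tail (suc k) with growTree r r-tail k
  ... | ts , t , inj₂ span = ts , t , inj₂ span
  ... | ts , t , inj₁ k≤ with Fin.any? (λ x → (vert x ∈? treeVerts r ts) ×-dec ¬? (hd x ∈? treeVerts r ts))
  ...   | yes (x , p , q) = x ∷ ts , grow t p q , inj₁ (s≤s k≤)
  ...   | no none = ts , t , inj₂ (closed⇒spanning r ts r-tail closed)
    where
    closed : ∀ x → vert x ∈ treeVerts r ts → hd x ∈ treeVerts r ts
    closed x p with hd x ∈? treeVerts r ts
    ... | yes q = q
    ... | no q = ⊥-elim (none (x , p , q))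

  spanningTree : ∃ λ ts → Tree (vert outer) ts × n ℕ.≤ suc (length ts)
  spanningTree with growTree (vert outer) (outer , refl) n
  -- A tree with `n` darts would have `n + 1` distinct vertices, so this case cannot occur; it
  -- yields the bound at once all the same.
  ... | ts , t , inj₁ h = ts , t , ℕ.m≤n⇒m≤1+n h
  ... | ts , t , inj₂ span = ts , t , spanning⇒≤ span

  -- Independence of tree edges and of faces

  col : (Dart → Bool) → (xs : List Dart) → Vec Bool (length xs)
  col f xs = Vec.map f (Vec.fromList xs)

  dot-col-false : ∀ {f xs} c → All (λ x → f x ≡ false) xs → dot (col f xs) c ≡ false
  dot-col-false [] [] = refl
  dot-col-false (y ∷ c) (p ∷ ps) rewrite p = dot-col-false c ps

  dot-col-cong : ∀ {f g} xs c → (∀ x → f x ≡ g x) → dot (col f xs) c ≡ dot (col g xs) c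
  dot-col-cong xs c h = cong (λ r → dot r c) (Vec.map-cong h (Vec.fromList xs))

  deg-dot : ∀ v ts c → deg v (λ y → dot (col (λ x → edge x y) ts) c) ≡ dot (col (incidence v) ts) c
  deg-dot v [] [] = deg-false v
  deg-dot v (x ∷ ts) (b ∷ c) = trans (deg-xor v (λ y → edge x y ∧ b) (λ y → dot (col (λ x → edge x y) ts) c))
    (cong₂ _xor_ (scale b) (deg-dot v ts c))
    where
    scale : ∀ b → deg v (λ y → edge x y ∧ b) ≡ incidence v x ∧ b
    scale false = trans (deg-cong v (λ y → ∧-zeroʳ (edge x y))) (trans (deg-false v) (sym (∧-zeroʳ _)))
    scale true = trans (deg-cong v (λ y → ∧-identityʳ (edge x y))) (trans (deg-edge v x) (sym (∧-identityʳ _)))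

  -- The most recently added dart is the only one touching its head.
  tree-independent : ∀ {r ts} → Tree r ts → ∀ c →
    (∀ v → dot (col (incidence v) ts) c ≡ false) → c ≡ zeros (length ts)
  tree-independent root [] h = refl
  tree-independent {r} (grow {x} {ts} t p q) (b ∷ c) h = cong₂ _∷_ b≡false (tree-independent t c rest)
    where
    old : All (λ y → incidence (hd x) y ≡ false) ts
    old = All.map (λ (e , e′) → cong₂ _xor_
      (δ-≢ (λ eq → q (subst (_∈ treeVerts r ts) eq e))) (δ-≢ (λ eq → q (subst (_∈ treeVerts r ts) eq e′))))
      (tree-ends t)
    new : incidence (hd x) x ≡ true
    new rewrite δ-refl (hd x) | δ-≢ (no-loop x) = refl
    b≡false : b ≡ false
    b≡false with h (hd x)
    ... | eq rewrite new | dot-col-false c old = trans (sym (xor-identityʳ b)) eq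
    rest : ∀ v → dot (col (incidence v) ts) c ≡ false
    rest v with h v
    ... | eq rewrite b≡false | ∧-zeroʳ (incidence v x) = eq

  -- All other listed faces vanish at the dart `r`, so evaluation there isolates the coefficient of
  -- `r`.
  faces-independent : ∀ {rs} → AllPairs (λ r s → ¬ SameFace G s r) rs → ∀ c →
    (∀ x → dot (col (λ r → face r x) rs) c ≡ false) → c ≡ zeros (length rs)
  faces-independent [] [] h = refl
  faces-independent {r ∷ rs} (r∉ ∷ rs-indep) (b ∷ c) h = cong₂ _∷_ b≡false (faces-independent rs-indep c rest)
    where
    b≡false : b ≡ false
    b≡false with h r
    ... | eq rewrite face-self r
        | dot-col-false {λ s → face s r} c (All.map (λ ¬same → ≢true⇒false (¬same ∘ face⇒SameFace)) r∉) =
          trans (sym (xor-identityʳ b)) eq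
    rest : ∀ x → dot (col (λ r → face r x) rs) c ≡ false
    rest x with h x
    ... | eq rewrite b≡false | ∧-zeroʳ (face r x) = eq

  -- Euler's formula and the inside of a closed path

  edges : List Dart
  edges = filterTrue (rep₂ α α-invol α-nofix)

  faces : List Dart
  faces = filterTrue (rep₃ φ φ-tri φ-nofix)

  faces-distinct : AllPairs (λ r s → ¬ SameFace G s r) faces
  faces-distinct = go (Unique.filter⁺ P? (Unique.allFin⁺ d)) (All.all-filter P? (allFin d))
    where
    P? = λ x → rep₃ φ φ-tri φ-nofix x Bool.≟ true
    go : ∀ {xs} → Unique xs → All (λ x → rep₃ φ φ-tri φ-nofix x ≡ true) xs → AllPairs (λ r s → ¬ SameFace G s r) xs
    go [] [] = []
    go (x∉ ∷ u) (p ∷ ps) =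
      All.zipWith (λ (x≢y , q) same → x≢y (sym (rep₃-unique φ φ-tri φ-nofix q p same))) (x∉ , ps) ∷ go u ps

  -- Since `d` is twice the number of edges and three times the number of faces, the factor 6 turns
  -- both sides into expressions in `d` and `n`.
  edge-face-count : length edges ℕ.+ 2 ≡ length faces ℕ.+ n
  edge-face-count = ℕ.*-cancelˡ-≡ _ _ 6 (begin
    6 ℕ.* (E ℕ.+ 2)                         ≡⟨ ℕsolve 1 (λ e → 𝟞 :×: (e :⊕: ℕcon 2) :≈: ℕcon 3 :×: (ℕcon 2 :×: e) :⊕: ℕcon 12) refl E ⟩
    3 ℕ.* (2 ℕ.* E) ℕ.+ 12                  ≡⟨ cong (λ z → 3 ℕ.* z ℕ.+ 12) (rep₂-count α α-invol α-nofix) ⟩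
    3 ℕ.* d ℕ.+ 12                          ≡⟨ ℕsolve 1 (λ e → ℕcon 3 :×: e :⊕: ℕcon 12 :≈: ℕcon 2 :×: e :⊕: (e :⊕: ℕcon 12)) refl d ⟩
    2 ℕ.* d ℕ.+ (d ℕ.+ 12)                  ≡⟨ cong₂ (λ y z → 2 ℕ.* y ℕ.+ z) (sym (rep₃-count φ φ-tri φ-nofix)) euler ⟩
    2 ℕ.* (3 ℕ.* F) ℕ.+ 6 ℕ.* n             ≡⟨ ℕsolve 2 (λ f m → ℕcon 2 :×: (ℕcon 3 :×: f) :⊕: 𝟞 :×: m :≈: 𝟞 :×: (f :⊕: m)) refl F n ⟩
    6 ℕ.* (F ℕ.+ n)                         ∎)
    where
    open ≡-Reasoning
    open ℕSolver.+-*-Solver renaming (solve to ℕsolve; con to ℕcon; _:+_ to _:⊕:_; _:*_ to _:×:_; _:=_ to _:≈:_)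
    𝟞 : ∀ {k} → Polynomial k
    𝟞 = ℕcon 6
    E = length edges
    F = length faces

  -- Complementary sets of faces have the same boundary; `inside-outer` selects one of the two.
  record Region (S : Dart → Bool) : Set where
    field
      inside   : Dart → Bool
      inside-φ : φ-Invariant inside
      inside-outer : inside outer ≡ false
      boundary : ∀ y → ∂ inside y ≡ S y
  open Region

  edges-total : ∀ y → y ∈ edges ⊎ α y ∈ edges
  edges-total y with rep₂-total α α-invol α-nofix y
  ... | inj₁ h = inj₁ (∈-filter⁺ (λ x → rep₂ α α-invol α-nofix x Bool.≟ true) (∈-allFin y) h)
  ... | inj₂ h = inj₂ (∈-filter⁺ (λ x → rep₂ α α-invol α-nofix x Bool.≟ true) (∈-allFin (α y)) h)

  -- If faces, closed path and tree edges outnumber edges and outer face, some nonzero combination of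
  -- the former vanishes on all edges and outside. The tree does not take part in it because all degrees
  -- are even, and the faces alone are independent once the outer one is excluded.
  module ClosedPath {u L} (closed : Path u L u)
    {fs} (fs-distinct : AllPairs (λ r s → ¬ SameFace G s r) fs)
    {es} (es-total : ∀ y → y ∈ es ⊎ α y ∈ es)
    {r ts} (tree : Tree r ts)
    (few : suc (length es) ℕ.< length fs ℕ.+ suc (length ts)) where

    rowEdge : Dart → Vec Bool (length fs ℕ.+ suc (length ts))
    rowEdge y = col (λ r → ∂ (face r) y) fs Vec.++ edgeSum L y ∷ col (λ x → edge x y) ts

    rowOuter : Vec Bool (length fs ℕ.+ suc (length ts))
    rowOuter = col (λ r → face r outer) fs Vec.++ zeros (suc (length ts))

    rows : List (Vec Bool (length fs ℕ.+ suc (length ts)))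
    rows = rowOuter ∷ List.map rowEdge es

    module Solution (cF : Vec Bool (length fs)) (t : Bool) (cT : Vec Bool (length ts))
      (nonzero : cF Vec.++ t ∷ cT ≢ zeros (length fs ℕ.+ suc (length ts)))
      (sol : All (λ r → dot r (cF Vec.++ t ∷ cT) ≡ false) rows) where

      I : Dart → Bool
      I x = dot (col (λ r → face r x) fs) cF

      I-φ : φ-Invariant I
      I-φ x = dot-col-cong fs cF (λ r → face-φ r x)

      I-outer : I outer ≡ false
      I-outer = trans (sym (trans (dot-++ (col (λ r → face r outer) fs) cF (zeros (suc (length ts))) (t ∷ cT))
        (trans (cong (I outer xor_) (dot-zerosˡ (t ∷ cT))) (xor-identityʳ (I outer))))) (All.head sol)

      τ : Dart → Bool
      τ y = dot (col (λ x → edge x y) ts) cT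

      rest : Dart → Bool
      rest y = (edgeSum L y ∧ t) xor τ y

      D : Dart → Bool
      D y = ∂ I y xor rest y

      D-α : ∀ y → D (α y) ≡ D y
      D-α y = cong₂ _xor_ (∂-α I y) (cong₂ _xor_ (cong (_∧ t) (edgeSum-αʳ L y))
        (dot-col-cong ts cT (λ x → edge-αʳ x y)))

      D-edges : ∀ {y} → y ∈ es → D y ≡ false
      D-edges {y} y∈ = trans (sym (trans
        (dot-++ (col (λ r → ∂ (face r) y) fs) cF (edgeSum L y ∷ col (λ x → edge x y) ts) (t ∷ cT))
        (cong (_xor rest y) (dot-map-xor (λ r → face r y) (λ r → face r (α y)) (Vec.fromList fs) cF))))
        (All.lookup (All.tail sol) (∈-map⁺ rowEdge y∈))

      D-zero : ∀ y → D y ≡ false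
      D-zero y with es-total y
      ... | inj₁ y∈ = D-edges y∈
      ... | inj₂ αy∈ = trans (sym (D-α y)) (D-edges αy∈)

      deg-scaled : ∀ v b → deg v (λ y → edgeSum L y ∧ b) ≡ false
      deg-scaled v false = trans (deg-cong v (λ y → ∧-zeroʳ (edgeSum L y))) (deg-false v)
      deg-scaled v true = trans (deg-cong v (λ y → ∧-identityʳ (edgeSum L y)))
        (trans (deg-path v u L u closed) (xor-same (δ u v)))

      cT-zero : cT ≡ zeros (length ts)
      cT-zero = tree-independent tree cT λ v → begin
        dot (col (incidence v) ts) cT       ≡⟨ deg-dot v ts cT ⟨
        deg v τ                             ≡⟨ cong (_xor deg v τ) (deg-scaled v t) ⟨
        deg v (λ y → edgeSum L y ∧ t) xor deg v τ
                                            ≡⟨ deg-xor v (λ y → edgeSum L y ∧ t) τ ⟨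
        deg v rest                          ≡⟨ cong (_xor deg v rest) (deg-∂ v I I-φ) ⟨
        deg v (∂ I) xor deg v rest          ≡⟨ deg-xor v (∂ I) rest ⟨
        deg v D                             ≡⟨ deg-cong v D-zero ⟩
        deg v (λ _ → false)                 ≡⟨ deg-false v ⟩
        false                               ∎
        where open ≡-Reasoning

      τ-zero : ∀ y → τ y ≡ false
      τ-zero y = trans (cong (dot (col (λ x → edge x y) ts)) cT-zero) (dot-zerosʳ (col (λ x → edge x y) ts))

      ∂I≡ : ∀ y → ∂ I y ≡ edgeSum L y ∧ t
      ∂I≡ y = trans (xor-false⇒≡ (D-zero y))
        (trans (cong ((edgeSum L y ∧ t) xor_) (τ-zero y)) (xor-identityʳ (edgeSum L y ∧ t)))

      t-true : t ≢ false
      t-true t≡false = nonzero (trans (cong₂ Vec._++_ cF-zero (cong₂ _∷_ t≡false cT-zero))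
        (zeros-++ (length fs) (suc (length ts))))
        where
        cF-zero : cF ≡ zeros (length fs)
        cF-zero = faces-independent fs-distinct cF (∂-injective I I-φ
          (λ y → trans (∂I≡ y) (trans (cong (edgeSum L y ∧_) t≡false) (∧-zeroʳ (edgeSum L y)))) I-outer)

      region : Region (edgeSum L)
      region = record
        { inside = I ; inside-φ = I-φ ; inside-outer = I-outer
        ; boundary = λ y → trans (∂I≡ y) (trans (cong (edgeSum L y ∧_) (≢false⇒true t-true)) (∧-identityʳ (edgeSum L y))) }

    solution⇒region : ∀ c → c ≢ zeros (length fs ℕ.+ suc (length ts)) →
      All (λ r → dot r c ≡ false) rows → Region (edgeSum L)
    solution⇒region c nonzero sol with Vec.splitAt (length fs) c
    ... | cF , t ∷ cT , refl = Solution.region cF t cT nonzero sol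

    region : Region (edgeSum L)
    region =
      let (c , nonzero , sol) = nontrivial-solution rows
            (subst (λ l → suc l ℕ.< length fs ℕ.+ suc (length ts)) (sym (length-map rowEdge es)) few)
      in solution⇒region c nonzero sol

  -- The combinatorial Jordan curve theorem, and the point where genus 0 enters. There are
  -- `length edges + 1` equations, one for each edge and one for the outer face. The unknowns belong
  -- to the faces, the closed path and at least `n - 1` tree edges, which by Euler's formula makes
  -- at least `length edges + 2`.
  jordan : ∀ {u L} → Path u L u → Region (edgeSum L)
  jordan closed =
    let (ts , tree , n≤) = spanningTree
    in ClosedPath.region closed faces-distinct edges-total tree (few ts n≤)
    where
    few : ∀ (ts : List Dart) → n ℕ.≤ suc (length ts) → suc (length edges) ℕ.< length faces ℕ.+ suc (length ts)
    few ts n≤ = begin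
      2 ℕ.+ length edges                    ≡⟨ ℕ.+-comm 2 (length edges) ⟩
      length edges ℕ.+ 2                    ≡⟨ edge-face-count ⟩
      length faces ℕ.+ n                    ≤⟨ ℕ.+-monoʳ-≤ (length faces) n≤ ⟩
      length faces ℕ.+ suc (length ts)      ∎
      where open ℕ.≤-Reasoning

  -- Paths and cycles as lists of darts

  path-++ : ∀ {u v w} xs {ys} → Path u xs v → Path v ys w → Path u (xs ++ ys) w
  path-++ [] refl q = q
  path-++ (x ∷ xs) (p , ps) q = p , path-++ xs ps q

  path-split : ∀ {u w} xs {ys} → Path u (xs ++ ys) w → ∃ λ v → Path u xs v × Path v ys w
  path-split [] q = _ , refl , q
  path-split (x ∷ xs) (p , q) with path-split xs q
  ... | v , r , s = v , (p , r) , s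

  path-at : ∀ {u v w} xs → Path u xs w → v ∈ List.map vert xs ⊎ v ≡ w →
    ∃₂ λ as bs → xs ≡ as ++ bs × Path u as v × Path v bs w
  path-at [] p (inj₂ refl) = [] , [] , refl , p , refl
  path-at (x ∷ xs) (refl , p) (inj₁ (here refl)) = [] , x ∷ xs , refl , refl , refl , p
  path-at (x ∷ xs) (q , p) (inj₁ (there m)) with path-at xs p (inj₁ m)
  ... | as , bs , refl , r , s = x ∷ as , bs , refl , (q , r) , s
  path-at (x ∷ xs) (q , p) (inj₂ m) with path-at xs p (inj₂ m)
  ... | as , bs , refl , r , s = x ∷ as , bs , refl , (q , r) , s

  path-target : ∀ {u u′ w w′ x} xs → Path u (x ∷ xs) w → Path u′ (x ∷ xs) w′ → w ≡ w′
  path-target [] (_ , refl) (_ , refl) = refl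
  path-target (x ∷ xs) (_ , p) (_ , q) = path-target xs p q

  path-heads : ∀ {u w} xs → Path u xs w → List.map vert xs ++ w ∷ [] ≡ u ∷ List.map hd xs
  path-heads [] refl = refl
  path-heads (x ∷ xs) (p , q) = cong₂ _∷_ p (path-heads xs q)

  record Cyc (L : List Dart) : Set where
    field
      {base}   : Fin n
      path     : Path base L base
      distinct : Unique (List.map vert L)
      long     : 3 ℕ.≤ length L
  open Cyc

  rotate : ∀ xs ys → Cyc (xs ++ ys) → Cyc (ys ++ xs)
  rotate xs ys c with path-split xs (path c)
  ... | v , p , q = record
    { path = path-++ ys q p
    ; distinct = subst Unique (sym (map-++ vert ys xs))
        (Unique-resp-↭ (++-comm (List.map vert xs) (List.map vert ys)) (subst Unique (map-++ vert xs ys) (distinct c)))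
    ; long = subst (3 ℕ.≤_) (↭-length (++-comm xs ys)) (long c) }

  -- The heads of a closed path are its tails shifted by one place.
  heads-distinct : ∀ {L} → Cyc L → Unique (List.map hd L)
  heads-distinct {[]} c = []
  heads-distinct {x ∷ xs} c with path c | distinct c
  ... | refl , p | u = subst Unique (path-heads xs p) (Unique-resp-↭ (++-comm (vert x ∷ []) (List.map vert xs)) u)

  hd∈ : ∀ {L} → Cyc L → ∀ {z} → z ∈ L → hd z ∈ List.map vert L
  hd∈ {x ∷ xs} c {z} z∈ with path c
  ... | refl , p with ∈-++⁻ (List.map vert xs) (subst (hd z ∈_) (sym (path-heads xs p)) (∈-map⁺ hd z∈))
  ...   | inj₁ q = there q
  ...   | inj₂ (here q) = here q

  edgeSum-++ : ∀ xs ys y → edgeSum (xs ++ ys) y ≡ edgeSum xs y xor edgeSum ys y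
  edgeSum-++ [] ys y = refl
  edgeSum-++ (x ∷ xs) ys y rewrite edgeSum-++ xs ys y =
    solve 3 (λ a b c → a :+ (b :+ c) := (a :+ b) :+ c) refl (edge x y) (edgeSum xs y) (edgeSum ys y)

  edgeSum-rotate : ∀ xs ys y → edgeSum (xs ++ ys) y ≡ edgeSum (ys ++ xs) y
  edgeSum-rotate xs ys y = trans (edgeSum-++ xs ys y)
    (trans (xor-comm (edgeSum xs y) (edgeSum ys y)) (sym (edgeSum-++ ys xs y)))

  edge-true : ∀ x y → edge x y ≡ true → y ≡ x ⊎ α y ≡ x
  edge-true x y h with xor-true⇒ (δ y x) h
  ... | inj₁ p = inj₁ (δ-true p)
  ... | inj₂ p = inj₂ (trans (cong α (δ-true p)) (α-invol x))

  edgeSum-true : ∀ L y → edgeSum L y ≡ true → y ∈ L ⊎ α y ∈ L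
  edgeSum-true (x ∷ L) y h with xor-true⇒ (edge x y) h
  ... | inj₁ p with edge-true x y p
  ...   | inj₁ refl = inj₁ (here refl)
  ...   | inj₂ refl = inj₂ (here refl)
  edgeSum-true (x ∷ L) y h | inj₂ p with edgeSum-true L y p
  ... | inj₁ q = inj₁ (there q)
  ... | inj₂ q = inj₂ (there q)

  edge-self : ∀ x → edge x x ≡ true
  edge-self x rewrite δ-refl x | δ-≢ (α-nofix x ∘ sym) = refl

  -- Nothing cancels in the sum: `x` cannot recur because tails are distinct. If `α x` occurred, it
  -- would have to follow `x` directly and lead back to the tail of `x`, which at length three or
  -- more would be repeated.
  edgeSum-head : ∀ {x R} → Cyc (x ∷ R) → edgeSum (x ∷ R) x ≡ true
  edgeSum-head {x} {R} c = cong₂ _xor_ (edge-self x) (≢true⇒false (no-repeat ∘ edgeSum-true R x))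
    where
    no-back : ∀ R → Path (hd x) R (vert x) → Unique (List.map vert (x ∷ R)) → 2 ℕ.≤ length R → α x ∈ R → ⊥
    no-back (_ ∷ []) _ _ (s≤s ())
    no-back (r ∷ s ∷ _) (r≡ , s≡ , _) ((_ ∷ x≢s ∷ _) ∷ u) _ αx∈ =
      x≢s (trans (trans (sym (hd-α x)) (cong hd αx≡r)) (sym s≡))
      where
      αx≡r : α x ≡ r
      αx≡r = Unique-map⇒injective u αx∈ (here refl) (sym r≡)
    no-repeat : x ∈ R ⊎ α x ∈ R → ⊥
    no-repeat (inj₁ x∈R) = All.lookup (All.map⁻ (AllPairs.head (distinct c))) x∈R refl
    no-repeat (inj₂ αx∈R) with path c
    ... | refl , p = no-back R p (distinct c) (ℕ.≤-pred (long c)) αx∈R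

  toFront : ∀ {L y} → Cyc L → y ∈ L → ∃ λ R → Cyc (y ∷ R) × (∀ z → edgeSum L z ≡ edgeSum (y ∷ R) z)
  toFront {y = y} c y∈ with ∈-∃++ y∈
  ... | xs , ys , refl = ys ++ xs , rotate xs (y ∷ ys) c , edgeSum-rotate xs (y ∷ ys)

  edgeSum-∈ : ∀ {L y} → Cyc L → y ∈ L → edgeSum L y ≡ true
  edgeSum-∈ c y∈ with toFront c y∈
  ... | R , c′ , eq = trans (eq _) (edgeSum-head c′)

  edgeSum-α∈ : ∀ {L y} → Cyc L → α y ∈ L → edgeSum L y ≡ true
  edgeSum-α∈ {L} {y} c αy∈ = trans (sym (edgeSum-αʳ L y)) (edgeSum-∈ c αy∈)

  vert-φφ : ∀ t → vert (φ (φ t)) ≡ hd (φ t)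
  vert-φφ t = φ-head (φ t)

  hd-φφ : ∀ t → hd (φ (φ t)) ≡ vert t
  hd-φφ t = trans (sym (φ-head (φ (φ t)))) (cong vert (φ-tri t))

  triangle-cyc : ∀ t → Cyc (triangle t)
  triangle-cyc t = record
    { path = refl , φ-head t , vert-φφ t , hd-φφ t
    ; distinct = ((λ h → no-loop t (trans h (φ-head t))) ∷
                  (λ h → no-loop (φ (φ t)) (trans (sym h) (sym (hd-φφ t)))) ∷ []) ∷
                 ((λ h → no-loop (φ t) (trans h (vert-φφ t))) ∷ []) ∷ [] ∷ []
    ; long = ℕ.≤-refl }

  -- Regions

  -- Every vertex of the cycle meets exactly two of its edges, and a boundary has even degrees.
  boundary-propagates : ∀ {x R} → Cyc (x ∷ R) → ∀ {J} → φ-Invariant J →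
    (∀ z → ∂ J z ≡ true → edgeSum (x ∷ R) z ≡ true) → ∂ J x ≡ true →
    ∀ {z} → z ∈ x ∷ R → ∂ J z ≡ true
  boundary-propagates {x} {R} c {J} inv ⊆L h = λ { (here refl) → h ; (there z∈) → All.lookup rest z∈ }
    where
    L = x ∷ R
    next : ∀ {a b} → a ∈ L → b ∈ L → vert b ≡ hd a → ∂ J a ≡ true → ∂ J b ≡ true
    next {a} {b} a∈ b∈ eq ha with ∂ J b in hb
    ... | true = refl
    ... | false = ⊥-elim (true≢false (trans (∂-α J a) ha)
          (trans (sym (deg-single (∂ J) (α a) others)) (deg-∂ (hd a) J inv)))
      where
      others : ∀ z → z ≢ α a → vert z ≡ hd a → ∂ J z ≡ false
      others z z≢ vz = ≢true⇒false λ hz → case-on hz (edgeSum-true L z (⊆L z hz))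
        where
        case-on : ∂ J z ≡ true → z ∈ L ⊎ α z ∈ L → ⊥
        case-on hz (inj₁ z∈) with Unique-map⇒injective (distinct c) z∈ b∈ (trans vz (sym eq))
        ... | refl = true≢false hz hb
        case-on hz (inj₂ αz∈) with Unique-map⇒injective (heads-distinct c) αz∈ a∈ (trans (hd-α z) vz)
        ... | refl = z≢ (sym (α-invol z))
    go : ∀ {a w} ys → a ∈ L → (∀ {y} → y ∈ ys → y ∈ L) → Path (hd a) ys w → ∂ J a ≡ true → All (λ z → ∂ J z ≡ true) ys
    go [] _ _ _ _ = []
    go (y ∷ ys) a∈ ys⊆ (eq , p) ha = hy ∷ go ys (ys⊆ (here refl)) (ys⊆ ∘ there) p hy
      where hy = next a∈ (ys⊆ (here refl)) eq ha
    rest : All (λ z → ∂ J z ≡ true) R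
    rest = go R (here refl) there (proj₂ (path c)) h

  record CycleList (S : Dart → Bool) (L : List Dart) : Set where
    field
      cyc  : Cyc L
      sums : ∀ y → S y ≡ edgeSum L y
  open CycleList

  ∂-xor : ∀ I J y → ∂ (λ x → I x xor J x) y ≡ ∂ I y xor ∂ J y
  ∂-xor I J y = solve 4 (λ a b c d → (a :+ b) :+ (c :+ d) := (a :+ c) :+ (b :+ d)) refl
    (I y) (J y) (I (α y)) (J (α y))

  -- The difference of the two sets has empty boundary and misses the outer face.
  region-unique : ∀ {S} (ρ : Region S) J → φ-Invariant J → J outer ≡ false →
    (∀ y → ∂ J y ≡ S y) → ∀ x → inside ρ x ≡ J x
  region-unique {S} ρ J J-φ J-out ∂J x = xor-false⇒≡ (∂-injective (λ x → inside ρ x xor J x)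
    (λ x → cong₂ _xor_ (inside-φ ρ x) (J-φ x))
    (λ y → trans (∂-xor (inside ρ) J y) (trans (cong₂ _xor_ (boundary ρ y) (∂J y)) (xor-same (S y))))
    (cong₂ _xor_ (inside-outer ρ) J-out) x)

  S-empty : ∀ {S} (ρ : Region S) → (∀ x → inside ρ x ≡ false) → ∀ y → S y ≡ false
  S-empty ρ h y = trans (sym (boundary ρ y)) (cong₂ _xor_ (h y) (h (α y)))

  -- The boundary of J = I′ ∖ I lies on the cycle, so it is empty or the whole cycle;
  -- in the latter case J = I, which is absurd.
  region-⊆ : ∀ {S L} → CycleList S L → (ρ : Region S) → ∀ I′ → φ-Invariant I′ → I′ outer ≡ false →
    (∀ y → ∂ I′ y ≡ true → S y ≡ true ⊎ inside ρ y ≡ true) →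
    ∀ x → I′ x ≡ true → inside ρ x ≡ true
  region-⊆ {S} {L} CL ρ I′ I′-φ I′-out hyp x I′x = conclude (I x) refl
    where
    I = inside ρ
    J : Dart → Bool
    J x = I′ x ∧ not (I x)
    J-φ : φ-Invariant J
    J-φ x = cong₂ (λ a b → a ∧ not b) (I′-φ x) (inside-φ ρ x)
    J-out : J outer ≡ false
    J-out rewrite I′-out = refl
    ∂J⊆S : ∀ y → ∂ J y ≡ true → S y ≡ true
    ∂J⊆S y h with S y in Sy
    ... | true = refl
    ... | false with ∖-boundary (I′ y) (I′ (α y)) (I y) (xor-false⇒≡ (trans (boundary ρ y) Sy)) h
    ...   | Iy , h′ with hyp y h′
    ...     | inj₁ p = trans (sym Sy) p
    ...     | inj₂ p = ⊥-elim (true≢false p Iy)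
    absurd : ∀ {z} → z ∈ L → ∂ J z ≡ true → ⊥
    absurd {z} z∈ hz with toFront (cyc CL) z∈
    ... | R , c , eq = true≢false (∂J⊆S z hz) (S-empty ρ I-empty z)
      where
      S≡ : ∀ y → S y ≡ edgeSum (z ∷ R) y
      S≡ y = trans (sums CL y) (eq y)
      all-true : ∀ {y} → y ∈ z ∷ R → ∂ J y ≡ true
      all-true = boundary-propagates c J-φ (λ y h → trans (sym (S≡ y)) (∂J⊆S y h)) hz
      S⊆∂J : ∀ y → S y ≡ true → ∂ J y ≡ true
      S⊆∂J y Sy with edgeSum-true (z ∷ R) y (trans (sym (S≡ y)) Sy)
      ... | inj₁ y∈ = all-true y∈
      ... | inj₂ αy∈ = trans (sym (∂-α J y)) (all-true αy∈)
      -- From `I′ ∖ I = I` it follows that `I` is empty, and then so is `S`, although it contains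
      -- `z`.
      I-empty : ∀ x → I x ≡ false
      I-empty x = ∧-not-absorbs (I′ x) (I x)
        (sym (region-unique ρ J J-φ J-out (λ y → ≡-from-true (∂J⊆S y) (S⊆∂J y)) x))
    ∂J-zero : ∀ y → ∂ J y ≡ false
    ∂J-zero y = ≢true⇒false λ h → on h (edgeSum-true L y (trans (sym (sums CL y)) (∂J⊆S y h)))
      where
      on : ∂ J y ≡ true → y ∈ L ⊎ α y ∈ L → ⊥
      on h (inj₁ y∈) = absurd y∈ h
      on h (inj₂ αy∈) = absurd αy∈ (trans (∂-α J y) h)
    conclude : ∀ b → I x ≡ b → b ≡ true
    conclude true _ = refl
    conclude false Ix with ∂-injective J J-φ ∂J-zero J-out x
    ... | Jx rewrite I′x | Ix = sym Jx

  -- Rotation about a vertex passes from face to face across the edges there. If none of them is a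
  -- boundary edge, membership never changes, and by `vert-orbit` the rotation reaches every dart at
  -- the vertex.
  constant-around : ∀ I → φ-Invariant I → ∀ {x y} → (∀ z → vert z ≡ vert x → ∂ I z ≡ false) →
    vert x ≡ vert y → I y ≡ I x
  constant-around I inv {x} {y} h eq with vert-orbit x y eq
  ... | k , refl = proj₂ (along k)
    where
    ρ = λ z → φ (α z)
    along : ∀ k → vert (iter ρ k x) ≡ vert x × I (iter ρ k x) ≡ I x
    along zero = refl , refl
    along (suc k) with along k
    ... | p , q = trans (φ-head (α z)) (trans (hd-α z) p) ,
                  trans (inv (α z)) (trans (sym (xor-false⇒≡ (h z p))) q)
      where z = iter ρ k x

  -- The two further sides g, h of the face t at its edge x, directed so that x, g, h is a closed walk
  -- whichever way t traverses x.
  record Sides (x t : Dart) : Set where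
    field
      g h     : Dart
      g-tail  : vert g ≡ hd x
      h-tail  : vert h ≡ hd g
      h-head  : hd h ≡ vert x
      sides-sum : ∀ y → edgeSum (triangle t) y ≡ edgeSum (x ∷ g ∷ h ∷ []) y
      g-side  : ∀ {J} → φ-Invariant J → J t ≡ true → J g ≡ true ⊎ J (α g) ≡ true
      h-side  : ∀ {J} → φ-Invariant J → J t ≡ true → J h ≡ true ⊎ J (α h) ≡ true
      apex    : ∀ {J} → φ-Invariant J → J t ≡ true → ∃ λ z → vert z ≡ hd g × J z ≡ true

    apex≢tail : hd g ≢ vert x
    apex≢tail eq = no-loop h (trans h-tail (trans eq (sym h-head)))

    apex≢head : hd g ≢ hd x
    apex≢head eq = no-loop g (trans g-tail (sym eq))

  sides : ∀ x t → t ≡ x ⊎ t ≡ α x → Sides x t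
  sides x t (inj₁ refl) = record
    { g = φ x ; h = φ (φ x) ; g-tail = φ-head x ; h-tail = vert-φφ x ; h-head = hd-φφ x
    ; sides-sum = λ y → refl
    ; g-side = λ inv Jt → inj₁ (trans (inv _) Jt)
    ; h-side = λ inv Jt → inj₁ (trans (inv _) (trans (inv _) Jt))
    ; apex = λ inv Jt → φ (φ x) , vert-φφ x , trans (inv _) (trans (inv _) Jt) }
  sides x t (inj₂ refl) = record
    { g = α (φ (φ (α x))) ; h = α (φ (α x))
    ; g-tail = hd-φφ (α x)
    ; h-tail = trans (sym (vert-φφ (α x))) (sym (hd-α _))
    ; h-head = trans (hd-α _) (trans (φ-head (α x)) (hd-α x))
    ; sides-sum = sums′
    ; g-side = λ {J} inv Jt → inj₂ (trans (cong J (α-invol _)) (trans (inv _) (trans (inv _) Jt)))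
    ; h-side = λ {J} inv Jt → inj₂ (trans (cong J (α-invol _)) (trans (inv _) Jt))
    ; apex = λ inv Jt → φ (φ (α x)) , sym (hd-α _) , trans (inv _) (trans (inv _) Jt) }
    where
    sums′ : ∀ y → edgeSum (triangle (α x)) y ≡ edgeSum (x ∷ α (φ (φ (α x))) ∷ α (φ (α x)) ∷ []) y
    sums′ y rewrite edge-αˡ x y | edge-αˡ (φ (φ (α x))) y | edge-αˡ (φ (α x)) y =
      solve 3 (λ a b c → a :+ (b :+ (c :+ con false)) := a :+ (c :+ (b :+ con false))) refl
        (edge x y) (edge (φ (α x)) y) (edge (φ (φ (α x))) y)

  SameFace-sum : ∀ {f t} → SameFace G f t → edgeSum (triangle f) t ≡ true
  SameFace-sum {f} same = edgeSum-∈ (triangle-cyc f) (on same)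
    where
    on : ∀ {t} → SameFace G f t → t ∈ triangle f
    on (inj₁ refl) = here refl
    on (inj₂ (inj₁ refl)) = there (here refl)
    on (inj₂ (inj₂ refl)) = there (there (here refl))

  triangle-φ : ∀ t y → edgeSum (triangle (φ t)) y ≡ edgeSum (triangle t) y
  triangle-φ t y rewrite φ-tri t = edgeSum-rotate (φ t ∷ φ (φ t) ∷ []) (t ∷ []) y

  triangle-SameFace : ∀ {f t} → SameFace G f t → ∀ y → edgeSum (triangle f) y ≡ edgeSum (triangle t) y
  triangle-SameFace (inj₁ refl) y = refl
  triangle-SameFace (inj₂ (inj₁ refl)) y = sym (triangle-φ _ y)
  triangle-SameFace (inj₂ (inj₂ refl)) y = sym (trans (triangle-φ _ y) (triangle-φ _ y))

  ∈-triangle⇒SameFace : ∀ {f t} → t ∈ triangle f → SameFace G f t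
  ∈-triangle⇒SameFace (here eq) = inj₁ eq
  ∈-triangle⇒SameFace (there (here eq)) = inj₂ (inj₁ eq)
  ∈-triangle⇒SameFace (there (there (here eq))) = inj₂ (inj₂ eq)

  Corner : ∀ {x t} → Sides x t → Fin n → Set
  Corner {x} T u = u ≡ vert x ⊎ u ≡ hd x ⊎ u ≡ hd (Sides.g T)

  corners : ∀ {x t} (T : Sides x t) y → edgeSum (triangle t) y ≡ true → Corner T (vert y) × Corner T (hd y)
  corners {x} T y on = ends (edgeSum-true (x ∷ g ∷ h ∷ []) y (trans (sym (sides-sum y)) on))
    where
    open Sides T
    ends-of : ∀ {y} → y ∈ x ∷ g ∷ h ∷ [] → Corner T (vert y) × Corner T (hd y)
    ends-of (here refl) = inj₁ refl , inj₂ (inj₁ refl)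
    ends-of (there (here refl)) = inj₂ (inj₁ g-tail) , inj₂ (inj₂ refl)
    ends-of (there (there (here refl))) = inj₂ (inj₂ h-tail) , inj₁ h-head
    ends : y ∈ x ∷ g ∷ h ∷ [] ⊎ α y ∈ x ∷ g ∷ h ∷ [] → Corner T (vert y) × Corner T (hd y)
    ends (inj₁ y∈) = ends-of y∈
    ends (inj₂ αy∈) = let (c , c′) = ends-of αy∈ in subst (Corner T) (hd-α y) c′ , c

  -- Removing a face

  edgeSum-replace₁ : ∀ {x t} (T : Sides x t) R y → let open Sides T in
    edgeSum (x ∷ R) y xor edgeSum (triangle t) y ≡ edgeSum (α h ∷ α g ∷ R) y
  edgeSum-replace₁ {x} T R y rewrite Sides.sides-sum T y | edge-αˡ (Sides.g T) y | edge-αˡ (Sides.h T) y =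
    solve 4 (λ x g h r → (x :+ r) :+ (x :+ (g :+ (h :+ con false))) := h :+ (g :+ r)) refl
      (edge x y) (edge (Sides.g T) y) (edge (Sides.h T) y) (edgeSum R y)

  edgeSum-replace₂ : ∀ {x t} (T : Sides x t) R y → let open Sides T in
    edgeSum (x ∷ g ∷ R) y xor edgeSum (triangle t) y ≡ edgeSum (α h ∷ R) y
  edgeSum-replace₂ {x} T R y rewrite Sides.sides-sum T y | edge-αˡ (Sides.h T) y =
    solve 4 (λ x g h r → (x :+ (g :+ r)) :+ (x :+ (g :+ (h :+ con false))) := h :+ r) refl
      (edge x y) (edge (Sides.g T) y) (edge (Sides.h T) y) (edgeSum R y)

  CycleList-rotate : ∀ {S} xs ys → CycleList S (xs ++ ys) → CycleList S (ys ++ xs)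
  CycleList-rotate xs ys CL = record
    { cyc = rotate xs ys (cyc CL) ; sums = λ y → trans (sums CL y) (edgeSum-rotate xs ys y) }

  CycleList-xor : ∀ {S L t L′} → CycleList S L → Cyc L′ →
    (∀ y → edgeSum L y xor edgeSum (triangle t) y ≡ edgeSum L′ y) →
    CycleList (λ y → S y xor edgeSum (triangle t) y) L′
  CycleList-xor {t = t} CL c eq = record
    { cyc = c ; sums = λ y → trans (cong (_xor edgeSum (triangle t) y) (sums CL y)) (eq y) }

  -- The edge `x` gives way to the detour over the apex. This is the only new vertex, and being off
  -- the cycle it keeps the tails distinct.
  cyc-replace₁ : ∀ {x t} (T : Sides x t) {R} → Cyc (x ∷ R) →
    hd (Sides.g T) ∉ List.map vert (x ∷ R) → Cyc (α (Sides.h T) ∷ α (Sides.g T) ∷ R)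
  cyc-replace₁ {x} T {R} c v∉ with path c | distinct c
  ... | refl , p | x∉ ∷ u = record
    { path = h-head , trans (sym h-tail) (sym (hd-α h)) ,
        subst (λ w → Path w R (vert x)) (sym (trans (hd-α g) g-tail)) p
    ; distinct = ((λ eq → apex≢tail (sym (trans (sym h-head) eq))) ∷
                    subst (λ w → All (w ≢_) (List.map vert R)) (sym h-head) x∉)
               ∷ All.tabulate (λ w∈ eq → v∉ (there (subst (_∈ List.map vert R) (sym eq) w∈))) ∷ u
    ; long = ℕ.m≤n⇒m≤1+n (long c) }
    where open Sides T

  -- The edges `x` and `g` give way to the third side; the bound on `R` keeps the result from
  -- shrinking to two darts.
  cyc-replace₂ : ∀ {x t} (T : Sides x t) {R} → Cyc (x ∷ Sides.g T ∷ R) → 2 ℕ.≤ length R →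
    Cyc (α (Sides.h T) ∷ R)
  cyc-replace₂ {x} T {R} c long′ with path c | distinct c
  ... | refl , _ , p | (_ ∷ x∉) ∷ _ ∷ u = record
    { path = h-head , subst (λ w → Path w R (vert x)) (sym (trans (hd-α h) h-tail)) p
    ; distinct = subst (λ w → All (w ≢_) (List.map vert R)) (sym h-head) x∉ ∷ u
    ; long = s≤s long′ }
    where open Sides T

  cyc-close : ∀ {P Q e} → Cyc (P ++ Q) → 2 ℕ.≤ length P → Path (hd e) P (vert e) → Cyc (e ∷ P)
  cyc-close {x ∷ P} {Q} {e} c long′ p with path-split (x ∷ P) {Q} (path c)
  -- With nothing left over, the path is closed by itself and `e` would be a loop.
  cyc-close {x ∷ P} {[]} {e} c long′ p | v , q , eq =
    ⊥-elim (no-loop e (trans (path-target P p q) (trans eq (trans (sym (proj₁ q)) (proj₁ p)))))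
  -- The dart `e` starts at the tail of `y`, which the given cycle already keeps apart from all
  -- tails of `x ∷ P`.
  cyc-close {x ∷ P} {y ∷ Q} {e} c long′ p | v , q , eq , _ with distinct (rotate (x ∷ P) (y ∷ Q) c)
  ... | y∉ ∷ u = record
    { path = refl , p
    ; distinct = subst (λ w → All (w ≢_) (List.map vert (x ∷ P))) (trans eq (path-target P q p))
        (All.map⁺ (All.++⁻ʳ Q (All.map⁻ y∉))) ∷ Unique-map-++ʳ Q u
    ; long = s≤s long′ }

  true-side : ∀ J y → ∂ J y ≡ true → ∃ λ t → (t ≡ y ⊎ t ≡ α y) × J t ≡ true
  true-side J y h with xor-true⇒ (J y) h
  ... | inj₁ p = y , inj₁ refl , p
  ... | inj₂ p = α y , inj₂ refl , p

  swap-sides : ∀ (J : Dart → Bool) {y} → J y ≡ true ⊎ J (α y) ≡ true → J (α y) ≡ true ⊎ J (α (α y)) ≡ true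
  swap-sides J {y} (inj₁ h) = inj₂ (trans (cong J (α-invol y)) h)
  swap-sides J (inj₂ h) = inj₁ h

  CycleList-α : ∀ {S L} → CycleList S L → ∀ y → S (α y) ≡ S y
  CycleList-α {L = L} CL y = trans (sums CL (α y)) (trans (edgeSum-αʳ L y) (sym (sums CL y)))

  CycleList-∈ : ∀ {S L} → CycleList S L → ∀ {y} → y ∈ L → S y ≡ true
  CycleList-∈ CL y∈ = trans (sums CL _) (edgeSum-∈ (cyc CL) y∈)

  -- Search for a removable face other than `f`

  module _ {S : Dart → Bool} (ρ : Region S) (f : Dart) (f-inside : inside ρ f ≡ true) where

    private
      I = inside ρ

    record Removable : Set where
      field
        t : Dart
        t-inside : inside ρ t ≡ true
        t-other  : ¬ SameFace G f t
        {cycle}  : List Dart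
        removed  : CycleList (λ y → S y xor edgeSum (triangle t) y) cycle

    -- By uniqueness the region bounded by the triangle of `t` is the face `t` alone, and `f` lies
    -- in it.
    S≡triangle⇒SameFace : ∀ {t} → I t ≡ true → (∀ y → S y ≡ edgeSum (triangle t) y) → SameFace G t f
    S≡triangle⇒SameFace {t} It eq = face⇒SameFace (trans (sym (region-unique ρ (face t) (face-φ t) t-outer
      (λ y → trans (∂-face t y) (sym (eq y))) f)) f-inside)
      where
      t-outer : face t outer ≡ false
      t-outer = ≢true⇒false λ h → true≢false It (trans (sym (SameFace-inv (inside-φ ρ) (face⇒SameFace h))) (inside-outer ρ))

    remove₁ : ∀ {x t R} → (T : Sides x t) → I t ≡ true → ¬ SameFace G f t → CycleList S (x ∷ R) →
      hd (Sides.g T) ∉ List.map vert (x ∷ R) → Removable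
    remove₁ {R = R} T It t≁f CL v∉ = record
      { t-inside = It ; t-other = t≁f
      ; removed = CycleList-xor CL (cyc-replace₁ T (cyc CL) v∉) (edgeSum-replace₁ T R) }

    remove₂ : ∀ {x t} R → (T : Sides x t) → I t ≡ true → ¬ SameFace G f t →
      CycleList S (x ∷ Sides.g T ∷ R) → Removable
    remove₂ {x} {t} [] T It t≁f CL with long (cyc CL)
    ... | s≤s (s≤s ())
    -- On a cycle of three edges the third one is `h`, as there are no multiple edges. The cycle is
    -- then the triangle of `t`, which forces `f` to be `t`.
    remove₂ {x} {t} (r ∷ []) T It t≁f CL with path (cyc CL)
    ... | refl , _ , r-tail , r-head with no-multi r (Sides.h T)
            (trans r-tail (sym (Sides.h-tail T))) (trans r-head (sym (Sides.h-head T)))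
    ...   | refl = ⊥-elim (t≁f (SameFace-sym (S≡triangle⇒SameFace It
              (λ y → trans (sums CL y) (sym (Sides.sides-sum T y))))))
    remove₂ {x} {t} R@(_ ∷ _ ∷ _) T It t≁f CL = record
      { t-inside = It ; t-other = t≁f
      ; removed = CycleList-xor CL (cyc-replace₂ T (cyc CL) (s≤s (s≤s ℕ.z≤n))) (edgeSum-replace₂ T R) }

    -- A vertex of `ρ₁` off its bounding cycle has all faces around it in `ρ₁`, hence in `ρ`, so no
    -- edge there separates the inside of `ρ` from its outside.
    off-cycle : ∀ {L} → Cyc L → (ρ₁ : Region (edgeSum L)) → (∀ x → inside ρ₁ x ≡ true → I x ≡ true) →
      ∀ {z₀ z} → inside ρ₁ z₀ ≡ true → vert z₀ ∉ List.map vert L → vert z₀ ≡ vert z → S z ≡ true → ⊥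
    off-cycle {L} c ρ₁ ⊆I {z₀} {z} I₁z₀ v∉ eq Sz = true≢false (trans (boundary ρ z) Sz)
      (cong₂ _xor_ (⊆I z I₁z) (⊆I (α z) (trans (sym (xor-false⇒≡ (flat z (sym eq)))) I₁z)))
      where
      flat : ∀ w → vert w ≡ vert z₀ → ∂ (inside ρ₁) w ≡ false
      flat w vw = trans (boundary ρ₁ w) (≢true⇒false (off ∘ edgeSum-true L w))
        where
        off : w ∈ L ⊎ α w ∈ L → ⊥
        off (inj₁ w∈) = v∉ (subst (_∈ List.map vert L) vw (∈-map⁺ vert w∈))
        off (inj₂ αw∈) = v∉ (subst (_∈ List.map vert L) (trans (hd-α w) vw) (hd∈ c αw∈))
      I₁z : inside ρ₁ z ≡ true
      I₁z = trans (constant-around (inside ρ₁) (inside-φ ρ₁) flat eq) I₁z₀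

    OnFace : Dart → Set
    OnFace x = edgeSum (triangle f) x ≡ true

    other-face : ∀ {x t} → t ≡ x ⊎ t ≡ α x → ¬ OnFace x → ¬ SameFace G f t
    other-face (inj₁ refl) x∉f same = x∉f (SameFace-sum same)
    other-face {x} (inj₂ refl) x∉f same = x∉f (trans (sym (edgeSum-αʳ (triangle f) x)) (SameFace-sum same))

    -- The statement for induction on the length of a subpath `P`. The dart `e` is a chord or, if
    -- `P` is all of the cycle but one edge, possibly that edge; in both cases the region lies on at
    -- least one side of it.
    RemovableAlong : ℕ → Set
    RemovableAlong k = ∀ P Q e → length P ℕ.≤ k → 2 ℕ.≤ length P → CycleList S (P ++ Q) →
      Path (hd e) P (vert e) → I e ≡ true ⊎ I (α e) ≡ true → (∀ {x} → x ∈ P → ¬ OnFace x) → Removable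

    inside-of-flat : ∀ {y} → S y ≡ false → I y ≡ true ⊎ I (α y) ≡ true → I y ≡ true
    inside-of-flat Sy (inj₁ h) = h
    inside-of-flat {y} Sy (inj₂ h) = trans (xor-false⇒≡ (trans (boundary ρ y) Sy)) h

    -- The boundary of `ρ₁` consists of edges of the cycle and of `e`, and `e` lies on the cycle or
    -- within the region; this is what `region-⊆` asks for.
    chord-region-⊆ : ∀ P Q e → CycleList S (P ++ Q) → I e ≡ true ⊎ I (α e) ≡ true →
      (ρ₁ : Region (edgeSum (e ∷ P))) → ∀ x → inside ρ₁ x ≡ true → I x ≡ true
    chord-region-⊆ P Q e CL e-inside ρ₁ = region-⊆ CL ρ (inside ρ₁) (inside-φ ρ₁) (inside-outer ρ₁) λ y h →
      on y (S y) refl (edgeSum-true (e ∷ P) y (trans (sym (boundary ρ₁ y)) h))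
      where
      on : ∀ y b → S y ≡ b → y ∈ e ∷ P ⊎ α y ∈ e ∷ P → S y ≡ true ⊎ I y ≡ true
      on y true Sy _ = inj₁ Sy
      on y false Sy (inj₁ (here refl)) = inj₂ (inside-of-flat Sy e-inside)
      on y false Sy (inj₁ (there y∈)) = inj₁ (CycleList-∈ CL (∈-++⁺ˡ y∈))
      on y false Sy (inj₂ (there αy∈)) = inj₁ (trans (sym (CycleList-α CL y)) (CycleList-∈ CL (∈-++⁺ˡ αy∈)))
      on y false Sy (inj₂ (here refl)) =
        inj₂ (trans (cong I (sym (α-invol y)))
          (inside-of-flat (trans (CycleList-α CL (α y)) (trans (CycleList-α CL y) Sy)) (swap-sides I e-inside)))

    -- The length of `as`, the way from the head of `x` to the apex, decides. Length zero would make
    -- `g` a loop. Length one means that `as` is `g`, so `t` has two consecutive edges on the cycle.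
    -- Otherwise `α g` closes `as`, which is shorter than the former subpath because `x` is gone.
    cut-off : ∀ {k} → RemovableAlong k → ∀ {x t} (T : Sides x t) as bs Q → length (as ++ bs) ℕ.≤ k →
      CycleList S (x ∷ (as ++ bs) ++ Q) → I t ≡ true → ¬ SameFace G f t →
      (∀ {y} → y ∈ as → ¬ OnFace y) → Path (hd x) as (hd (Sides.g T)) → Removable
    cut-off rec T [] bs Q ≤k CL It t≁f as∉f q = ⊥-elim (Sides.apex≢head T (sym q))
    cut-off rec T (a ∷ []) bs Q ≤k CL It t≁f as∉f (a-tail , a-head)
      with no-multi a (Sides.g T) (trans a-tail (sym (Sides.g-tail T))) a-head
    ... | refl = remove₂ (bs ++ Q) T It t≁f CL
    cut-off rec {x} T as@(_ ∷ _ ∷ _) bs Q ≤k CL It t≁f as∉f q =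
      rec as ((bs ++ Q) ++ x ∷ []) (α g) (ℕ.≤-trans (subst (length as ℕ.≤_) (sym (length-++ as)) (ℕ.m≤m+n _ _)) ≤k)
        (s≤s (s≤s ℕ.z≤n))
        (subst (CycleList S) (++-assoc as (bs ++ Q) (x ∷ []))
          (CycleList-rotate (x ∷ []) (as ++ bs ++ Q) (subst (λ L → CycleList S (x ∷ L)) (++-assoc as bs Q) CL)))
        (subst (λ w → Path w as (hd g)) (sym (trans (hd-α g) g-tail)) q)
        (swap-sides I (g-side (inside-φ ρ) It)) as∉f
      where open Sides T

    -- Let e close the subpath P of the cycle, bounding a region I₁ within I, and consider the face of I₁
    -- at the first edge of P. Its apex is either off the cycle or on P; in the latter case the face
    -- has two edges on the cycle or cuts off a shorter subpath of P.
    removable-step : ∀ {k} → RemovableAlong k → ∀ x P Q e → length P ℕ.≤ k → CycleList S (x ∷ P ++ Q) →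
      Path (hd x) P (vert e) → I e ≡ true ⊎ I (α e) ≡ true → (∀ {y} → y ∈ x ∷ P → ¬ OnFace y) →
      Cyc (e ∷ x ∷ P) → (ρ₁ : Region (edgeSum (e ∷ x ∷ P))) →
      ∀ t → t ≡ x ⊎ t ≡ α x → inside ρ₁ t ≡ true → Removable
    removable-step rec x P Q e P≤k CL p e-inside P∉f c₁ ρ₁ t t-on-x I₁t = split (hd g ∈? List.map vert (x ∷ P ++ Q))
      where
      I₁⊆I : ∀ x → inside ρ₁ x ≡ true → I x ≡ true
      I₁⊆I = chord-region-⊆ (x ∷ P) Q e CL e-inside ρ₁
      T : Sides x t
      T = sides x t t-on-x
      open Sides T
      apex-on : hd g ∈ List.map vert (x ∷ P ++ Q) → Dec (hd g ∈ List.map vert (e ∷ x ∷ P)) →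
        hd g ∈ List.map vert P ⊎ hd g ≡ vert e
      apex-on v∈ (yes (here eq)) = inj₂ eq
      apex-on v∈ (yes (there (here eq))) = ⊥-elim (apex≢tail eq)
      apex-on v∈ (yes (there (there v∈P))) = inj₁ v∈P
      -- An apex off the cycle `e ∷ x ∷ P` is interior to `ρ₁`, so by `off-cycle` no edge of the
      -- large cycle starts there.
      apex-on v∈ (no v∉) =
        let (z₀ , vz₀ , I₁z₀) = apex (inside-φ ρ₁) I₁t
            (z , z∈ , vz) = ∈-map⁻ vert v∈
        in ⊥-elim (off-cycle c₁ ρ₁ I₁⊆I I₁z₀
             (v∉ ∘ subst (_∈ List.map vert (e ∷ x ∷ P)) vz₀) (trans vz₀ vz) (CycleList-∈ CL z∈))
      cut : ∀ {as bs} → P ≡ as ++ bs → Path (hd x) as (hd g) → Removable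
      cut {as} {bs} refl q = cut-off rec T as bs Q P≤k CL (I₁⊆I t I₁t)
        (other-face t-on-x (P∉f (here refl))) (P∉f ∘ there ∘ ∈-++⁺ˡ) q
      split : Dec (hd g ∈ List.map vert (x ∷ P ++ Q)) → Removable
      split (no v∉) = remove₁ T (I₁⊆I t I₁t) (other-face t-on-x (P∉f (here refl))) CL v∉
      split (yes v∈) =
        let (_ , _ , eq , q , _) = path-at P p (apex-on v∈ (hd g ∈? List.map vert (e ∷ x ∷ P)))
        in cut eq q

    removable-along : ∀ k → RemovableAlong k
    removable-along (suc k) (x ∷ P) Q e (s≤s P≤k) long′ CL p e-inside P∉f =
      let c₁ = cyc-close {Q = Q} (cyc CL) long′ p
          ρ₁ = jordan (path c₁)
          (t , t-on-x , I₁t) = true-side (inside ρ₁) x (trans (boundary ρ₁ x) (edgeSum-∈ c₁ (there (here refl))))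
      in removable-step (removable-along k) x P Q e P≤k CL (proj₂ p) e-inside P∉f c₁ ρ₁ t t-on-x I₁t

    -- The corners of `f` are `s`, `r` and `w`, and only `s` is a tail of `P`. An edge of `P` on `f`
    -- would thus be the first one, and its head, being the second tail of `P`, could not be a
    -- corner.
    avoids-face : ∀ {s r w} P → Path s P r → Unique (List.map vert P) → 2 ℕ.≤ length P →
      r ∉ List.map vert P → w ∉ List.map vert P →
      (∀ y → OnFace y → (vert y ≡ s ⊎ vert y ≡ r ⊎ vert y ≡ w) × (hd y ≡ s ⊎ hd y ≡ r ⊎ hd y ≡ w)) →
      ∀ {y} → y ∈ P → ¬ OnFace y
    avoids-face (_ ∷ []) _ _ (s≤s ())
    avoids-face {s} {r} {w} P@(a ∷ b ∷ P′) (a≡ , b≡ , _) u _ r∉ w∉ ends {y} y∈ on with ends y on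
    ... | inj₂ (inj₁ eq) , _ = r∉ (subst (_∈ List.map vert P) eq (∈-map⁺ vert y∈))
    ... | inj₂ (inj₂ eq) , _ = w∉ (subst (_∈ List.map vert P) eq (∈-map⁺ vert y∈))
    ... | inj₁ eq , h with Unique-map⇒injective u y∈ (here refl) (trans eq (sym a≡))
    ...   | refl with h | u
    ...     | inj₁ eq′ | (a≢b ∷ _) ∷ _ = a≢b (trans a≡ (trans (sym eq′) (sym b≡)))
    ...     | inj₂ (inj₁ eq′) | _ = r∉ (there (here (trans (sym eq′) (sym b≡))))
    ...     | inj₂ (inj₂ eq′) | _ = w∉ (there (here (trans (sym eq′) (sym b≡))))

    -- The case where `e` is a side of `f` itself and `w` the opposite corner: a path between the
    -- ends of `e` that misses `w` and has at least two edges contains no edge of `f`.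
    removable-from : ∀ {x t} (T : Sides x t) → (∀ y → edgeSum (triangle f) y ≡ edgeSum (triangle t) y) →
      ∀ P Q e {w} → CycleList S (P ++ Q) → 2 ℕ.≤ length P → Path (hd e) P (vert e) →
      I e ≡ true ⊎ I (α e) ≡ true → w ∉ List.map vert P →
      (∀ {u} → Corner T u → u ≡ hd e ⊎ u ≡ vert e ⊎ u ≡ w) → Removable
    removable-from T f≡t P Q e CL long′ p e-inside w∉ toEnds with distinct (cyc-close {Q = Q} (cyc CL) long′ p)
    ... | e∉ ∷ u = removable-along (length P) P Q e ℕ.≤-refl long′ CL p e-inside
      (avoids-face P p u long′ (λ e∈ → All.lookup e∉ e∈ refl) w∉
        (λ y on → let (c , c′) = corners T y (trans (sym (f≡t y)) on) in toEnds c , toEnds c′))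

    -- If `f` has the edge `x` on the cycle, a suitable side of `f` serves as `e`: `x` itself when
    -- the apex is off the cycle, otherwise `g`, or `h` if `g` already runs along the cycle. If `h`
    -- does so too, the cycle is the triangle of `f`.
    removable-at : ∀ {x t R} → t ≡ x ⊎ t ≡ α x → (∀ y → edgeSum (triangle f) y ≡ edgeSum (triangle t) y) →
      I t ≡ true → CycleList S (x ∷ R) → ¬ (∀ y → S y ≡ edgeSum (triangle f) y) → Removable
    removable-at {x} {t} {R} t-on-x f≡t It CL S≢f with path (cyc CL) | distinct (cyc CL)
    ... | refl , p | x∉ ∷ u = split (hd g ∈? List.map vert R)
      where
      T = sides x t t-on-x
      open Sides T
      x-side : ∀ {t} → t ≡ x ⊎ t ≡ α x → I t ≡ true → I x ≡ true ⊎ I (α x) ≡ true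
      x-side (inj₁ refl) h = inj₁ h
      x-side (inj₂ refl) h = inj₂ h
      vert-x∉ : ∀ as {bs} → R ≡ as ++ bs → vert x ∉ List.map vert as
      vert-x∉ as refl v∈ = let (z , z∈ , eq) = ∈-map⁻ vert v∈ in All.lookup (All.map⁻ x∉) (∈-++⁺ˡ z∈) eq
      cut : ∀ as bs → R ≡ as ++ bs → Path (hd x) as (hd g) → Path (hd g) bs (vert x) → Removable
      cut [] bs eq q q′ = ⊥-elim (apex≢head (sym q))
      cut (a ∷ []) bs eq (a-tail , a-head) q′ with no-multi a g (trans a-tail (sym g-tail)) a-head
      cut (a ∷ []) [] eq q q′ | refl = ⊥-elim (apex≢tail q′)
      cut (a ∷ []) (b ∷ []) refl q (b-tail , b-head) | refl
        with no-multi b h (trans b-tail (sym h-tail)) (trans b-head (sym h-head))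
      ... | refl = ⊥-elim (S≢f λ y → trans (sums CL y) (trans (sym (sides-sum y)) (sym (f≡t y))))
      cut (a ∷ []) bs@(_ ∷ _ ∷ _) refl (a-tail , _) q′ | refl =
        removable-from T f≡t bs (x ∷ a ∷ []) (α h) (CycleList-rotate (x ∷ a ∷ []) bs CL) (s≤s (s≤s ℕ.z≤n))
          (subst₂ (λ v w → Path v bs w) (sym (trans (hd-α h) h-tail)) (sym h-head) q′)
          (swap-sides I (h-side (inside-φ ρ) It))
          (λ v∈ → All.lookup (AllPairs.head u) v∈ a-tail)
          λ { (inj₁ eq) → inj₂ (inj₁ (trans eq (sym h-head)))
            ; (inj₂ (inj₁ eq)) → inj₂ (inj₂ eq)
            ; (inj₂ (inj₂ eq)) → inj₁ (trans eq (sym (trans (hd-α h) h-tail))) }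
      cut as@(_ ∷ _ ∷ _) bs refl q q′ =
        removable-from T f≡t as (bs ++ x ∷ []) (α g)
          (subst (CycleList S) (++-assoc as bs (x ∷ [])) (CycleList-rotate (x ∷ []) (as ++ bs) CL)) (s≤s (s≤s ℕ.z≤n))
          (subst (λ w → Path w as (hd g)) (sym (trans (hd-α g) g-tail)) q)
          (swap-sides I (g-side (inside-φ ρ) It))
          (vert-x∉ as refl)
          λ { (inj₁ eq) → inj₂ (inj₂ eq)
            ; (inj₂ (inj₁ eq)) → inj₁ (trans eq (sym (trans (hd-α g) g-tail)))
            ; (inj₂ (inj₂ eq)) → inj₂ (inj₁ eq) }
      split : Dec (hd g ∈ List.map vert R) → Removable
      split (yes v∈) = let (as , bs , eq , q , q′) = path-at R p (inj₁ v∈) in cut as bs eq q q′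
      split (no v∉) = removable-from T f≡t R (x ∷ []) x (CycleList-rotate (x ∷ []) R CL)
        (ℕ.≤-pred (long (cyc CL))) p (x-side t-on-x It) v∉
        λ { (inj₁ eq) → inj₂ (inj₁ eq) ; (inj₂ (inj₁ eq)) → inj₁ eq ; (inj₂ (inj₂ eq)) → inj₂ (inj₂ eq) }

    removable : ∀ {L} → CycleList S L → ¬ (∀ y → S y ≡ edgeSum (triangle f) y) → Removable
    removable {L} CL S≢f = search L CL (any? (λ x → edgeSum (triangle f) x Bool.≟ true) L)
      where
      search : ∀ L → CycleList S L → Dec (Any.Any (λ x → edgeSum (triangle f) x ≡ true) L) → Removable
      search [] CL _ with () ← long (cyc CL)
      search (x ∷ P) CL (no none) with path (cyc CL)
      -- No edge of the cycle is on `f`, so its first edge can play the part of `e` for all the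
      -- others.
      ... | refl , p = removable-along (length P) P (x ∷ []) x ℕ.≤-refl (ℕ.≤-pred (long (cyc CL)))
        (CycleList-rotate (x ∷ []) P CL) p
        (xor-true⇒ (I x) (trans (boundary ρ x) (CycleList-∈ CL (here refl))))
        (λ y∈ on → none (there (Any.map (λ { refl → on }) y∈)))
      search L@(_ ∷ _) CL (yes some) =
        let (x , x∈ , on) = find some
            (R , c , eq) = toFront (cyc CL) x∈
        in at (record { cyc = c ; sums = λ y → trans (sums CL y) (eq y) }) (edgeSum-true (triangle f) x on)
        where
        at : ∀ {x R} → CycleList S (x ∷ R) → x ∈ triangle f ⊎ α x ∈ triangle f → Removable
        at CL (inj₁ x∈) = let same = ∈-triangle⇒SameFace x∈ in
          removable-at (inj₁ refl) (triangle-SameFace same) (trans (SameFace-inv (inside-φ ρ) same) f-inside) CL S≢f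
        at CL (inj₂ αx∈) = let same = ∈-triangle⇒SameFace αx∈ in
          removable-at (inj₂ refl) (triangle-SameFace same) (trans (SameFace-inv (inside-φ ρ) same) f-inside) CL S≢f

  -- Cycles and faces as sets of darts

  path-lookup : ∀ {u w} x xs → Path u (x ∷ xs) w →
    (∀ i → hd (List.lookup (x ∷ xs) (inject₁ i)) ≡ vert (List.lookup (x ∷ xs) (suc i))) ×
    hd (List.lookup (x ∷ xs) (fromℕ (length xs))) ≡ w
  path-lookup x [] (_ , p) = (λ ()) , p
  path-lookup x (y ∷ xs) (_ , eq , p) with path-lookup y xs (refl , p)
  ... | steps , last = (λ { zero → sym eq ; (suc i) → steps i }) , last

  path-tabulate : ∀ {m w} (ds : Fin (suc m) → Dart) →
    (∀ i → hd (ds (inject₁ i)) ≡ vert (ds (suc i))) → hd (ds (fromℕ m)) ≡ w →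
    Path (vert (ds zero)) (List.tabulate ds) w
  path-tabulate {zero} ds steps last = refl , last
  path-tabulate {suc m} {w} ds steps last =
    refl , subst (λ u → Path u (List.tabulate (ds ∘ suc)) w) (sym (steps zero)) (path-tabulate (ds ∘ suc) (steps ∘ suc) last)

  lookup-vert-injective : ∀ L → Unique (List.map vert L) →
    ∀ i j → vert (List.lookup L i) ≡ vert (List.lookup L j) → i ≡ j
  lookup-vert-injective (x ∷ L) u zero zero eq = refl
  lookup-vert-injective (x ∷ L) (x∉ ∷ u) zero (suc j) eq = ⊥-elim (All.lookup (All.map⁻ x∉) (∈-lookup j) eq)
  lookup-vert-injective (x ∷ L) (x∉ ∷ u) (suc i) zero eq = ⊥-elim (All.lookup (All.map⁻ x∉) (∈-lookup i) (sym eq))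
  lookup-vert-injective (x ∷ L) (x∉ ∷ u) (suc i) (suc j) eq = cong suc (lookup-vert-injective L u i j eq)

  CycleList⇒IsCycle : ∀ {S L} → CycleList S L → IsCycle G S
  CycleList⇒IsCycle {L = []} CL with () ← long (cyc CL)
  CycleList⇒IsCycle {L = _ ∷ []} CL with s≤s () ← long (cyc CL)
  CycleList⇒IsCycle {L = _ ∷ _ ∷ []} CL with s≤s (s≤s ()) ← long (cyc CL)
  CycleList⇒IsCycle {S} {L = L@(x ∷ xs@(_ ∷ _ ∷ rest))} CL =
    let p = path-lookup x xs (path (cyc CL)) in
    length rest , List.lookup L , proj₁ p ,
    trans (proj₂ p) (sym (proj₁ (path (cyc CL)))) ,
    lookup-vert-injective L (distinct (cyc CL)) , λ y → mk⇔ (to y ∘ edgeSum-true L y ∘ trans (sym (sums CL y))) (from y)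
    where
    to : ∀ y → y ∈ L ⊎ α y ∈ L → ∃ λ i → y ≡ List.lookup L i ⊎ y ≡ α (List.lookup L i)
    to y (inj₁ y∈) = Any.index y∈ , inj₁ (Any.lookup-index y∈)
    to y (inj₂ αy∈) = Any.index αy∈ , inj₂ (trans (sym (α-invol y)) (cong α (Any.lookup-index αy∈)))
    from : ∀ y → (∃ λ i → y ≡ List.lookup L i ⊎ y ≡ α (List.lookup L i)) → S y ≡ true
    from y (i , inj₁ refl) = trans (sums CL y) (edgeSum-∈ (cyc CL) (∈-lookup i))
    from y (i , inj₂ refl) = trans (sums CL y) (edgeSum-α∈ (cyc CL) (subst (_∈ L) (sym (α-invol _)) (∈-lookup {xs = L} i)))

  IsCycle⇒CycleList : ∀ {S} → IsCycle G S → ∃ (CycleList S)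
  IsCycle⇒CycleList {S} (m , ds , steps , last , injective , S⇔) = L , record
    { cyc = c
    ; sums = λ y → ≡-from-true (on y ∘ Equivalence.to (S⇔ y)) (Equivalence.from (S⇔ y) ∘ off y ∘ edgeSum-true L y) }
    where
    L = List.tabulate ds
    c : Cyc L
    c = record
      { path = path-tabulate ds steps last
      ; distinct = subst Unique (sym (map-tabulate ds vert)) (Unique.tabulate⁺ (injective _ _))
      ; long = subst (3 ℕ.≤_) (sym (length-tabulate ds)) (s≤s (s≤s (s≤s ℕ.z≤n))) }
    on : ∀ y → (∃ λ i → y ≡ ds i ⊎ y ≡ α (ds i)) → edgeSum L y ≡ true
    on y (i , inj₁ refl) = edgeSum-∈ c (∈-tabulate⁺ {f = ds} i)
    on y (i , inj₂ refl) = edgeSum-α∈ c (subst (_∈ L) (sym (α-invol _)) (∈-tabulate⁺ {f = ds} i))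
    off : ∀ y → y ∈ L ⊎ α y ∈ L → ∃ λ i → y ≡ ds i ⊎ y ≡ α (ds i)
    off y (inj₁ y∈) = let (i , eq) = ∈-tabulate⁻ {f = ds} y∈ in i , inj₁ eq
    off y (inj₂ αy∈) = let (i , eq) = ∈-tabulate⁻ {f = ds} αy∈ in i , inj₂ (trans (sym (α-invol y)) (cong α eq))

  -- The edges of a triangle are distinct, so disjunction and sum modulo 2 agree.
  faceSet-sum : ∀ t y → faceSet G t y ≡ edgeSum (triangle t) y
  faceSet-sum t y = ≡-from-true to (from ∘ edgeSum-true (triangle t) y)
    where
    c = triangle-cyc t
    back : ∀ {z} → z ∈ triangle t → y ≡ α z → edgeSum (triangle t) y ≡ true
    back {z} z∈ refl = edgeSum-α∈ c (subst (_∈ triangle t) (sym (α-invol z)) z∈)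
    forth : ∀ {z} → α y ≡ z → y ≡ α z
    forth eq = trans (sym (α-invol y)) (cong α eq)
    to : faceSet G t y ≡ true → edgeSum (triangle t) y ≡ true
    to h with ∨-true (δ y t) h
    ... | inj₁ p = edgeSum-∈ c (here (δ-true p))
    ... | inj₂ h with ∨-true (δ y (φ t)) h
    ... | inj₁ p = edgeSum-∈ c (there (here (δ-true p)))
    ... | inj₂ h with ∨-true (δ y (φ (φ t))) h
    ... | inj₁ p = edgeSum-∈ c (there (there (here (δ-true p))))
    ... | inj₂ h with ∨-true (δ y (α t)) h
    ... | inj₁ p = back (here refl) (δ-true p)
    ... | inj₂ h with ∨-true (δ y (α (φ t))) h
    ... | inj₁ p = back (there (here refl)) (δ-true p)
    ... | inj₂ p = back (there (there (here refl))) (δ-true p)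
    from : y ∈ triangle t ⊎ α y ∈ triangle t → faceSet G t y ≡ true
    from (inj₁ (here eq)) = ∨-trueˡ _ (δ-≡ eq)
    from (inj₁ (there (here eq))) = ∨-trueʳ (δ y t) (∨-trueˡ _ (δ-≡ eq))
    from (inj₁ (there (there (here eq)))) = ∨-trueʳ (δ y t) (∨-trueʳ (δ y (φ t)) (∨-trueˡ _ (δ-≡ eq)))
    from (inj₂ (here eq)) =
      ∨-trueʳ (δ y t) (∨-trueʳ (δ y (φ t)) (∨-trueʳ (δ y (φ (φ t))) (∨-trueˡ _ (δ-≡ (forth eq)))))
    from (inj₂ (there (here eq))) =
      ∨-trueʳ (δ y t) (∨-trueʳ (δ y (φ t)) (∨-trueʳ (δ y (φ (φ t))) (∨-trueʳ (δ y (α t)) (∨-trueˡ _ (δ-≡ (forth eq))))))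
    from (inj₂ (there (there (here eq)))) =
      ∨-trueʳ (δ y t) (∨-trueʳ (δ y (φ t)) (∨-trueʳ (δ y (φ (φ t))) (∨-trueʳ (δ y (α t)) (∨-trueʳ (δ y (α (φ t))) (δ-≡ (forth eq))))))

  -- Chains

  IsCycle-resp : ∀ {S T} → (∀ y → S y ≡ T y) → IsCycle G S → IsCycle G T
  IsCycle-resp eq (m , ds , steps , last , injective , S⇔) = m , ds , steps , last , injective , λ y →
    mk⇔ (Equivalence.to (S⇔ y) ∘ trans (eq y)) (trans (sym (eq y)) ∘ Equivalence.from (S⇔ y))

  GoodChain-resp : ∀ {S T} cs {U} → (∀ y → S y ≡ T y) → GoodChain G S cs U → GoodChain G T cs U
  GoodChain-resp [] eq h y = trans (sym (eq y)) (h y)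
  GoodChain-resp (c ∷ cs) eq (isCycle , h) =
    IsCycle-resp eq′ isCycle , GoodChain-resp cs eq′ h
    where eq′ = λ y → cong (_xor c y) (eq y)

  -- A chain unfolds from its front, whereas shelling strips the face that is added last; appending
  -- reconciles the two.
  GoodChain-snoc : ∀ {S} cs {U c V} → GoodChain G S cs U → (∀ y → U y xor c y ≡ V y) → IsCycle G V →
    GoodChain G S (cs ++ c ∷ []) V
  GoodChain-snoc [] {c = c} h eq isCycle =
    IsCycle-resp (sym ∘ eq′) isCycle , eq′
    where eq′ = λ y → trans (cong (_xor c y) (h y)) (eq y)
  GoodChain-snoc (_ ∷ cs) (isCycle′ , h) eq isCycle = isCycle′ , GoodChain-snoc cs h eq isCycle

  -- Shelling a region

  InsideFace : (Dart → Bool) → Dart → EdgeSet G → Set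
  InsideFace I f c = ∃ λ x → I x ≡ true × ¬ SameFace G f x × (∀ y → c y ≡ faceSet G x y)

  removeFace : ∀ {S} (ρ : Region S) t → inside ρ t ≡ true → Region (λ y → S y xor edgeSum (triangle t) y)
  removeFace ρ t It = record
    { inside = λ x → inside ρ x xor face t x
    ; inside-φ = λ x → cong₂ _xor_ (inside-φ ρ x) (face-φ t x)
    ; inside-outer = cong₂ _xor_ (inside-outer ρ) (≢true⇒false λ h →
        true≢false It (trans (sym (SameFace-inv (inside-φ ρ) (face⇒SameFace h))) (inside-outer ρ)))
    ; boundary = λ y → trans (∂-xor (inside ρ) (face t) y) (cong₂ _xor_ (boundary ρ y) (∂-face t y)) }

  removeFace-⊆ : ∀ {S} (ρ : Region S) t (It : inside ρ t ≡ true) x →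
    inside (removeFace ρ t It) x ≡ true → inside ρ x ≡ true
  removeFace-⊆ ρ t It x h with xor-true⇒ (inside ρ x) h
  ... | inj₁ Ix = Ix
  ... | inj₂ x∈t = trans (SameFace-inv (inside-φ ρ) (face⇒SameFace x∈t)) It

  -- The bound `k` on the number of darts inside makes the recursion structural. The removed face
  -- becomes the last summand, since adding it once more restores `S`.
  shelling : ∀ k {S L} → CycleList S L → (ρ : Region S) → ∀ f → inside ρ f ≡ true → count (inside ρ) ℕ.≤ k →
    ∃ λ cs → All (InsideFace (inside ρ) f) cs × GoodChain G (faceSet G f) cs S
  shelling k {S} CL ρ f If bound with Fin.all? (λ y → S y Bool.≟ edgeSum (triangle f) y)
  ... | yes S≡f = [] , [] , λ y → trans (faceSet-sum f y) (sym (S≡f y))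
  ... | no S≢f = remove k bound (removable ρ f If CL S≢f)
    where
    remove : ∀ k → count (inside ρ) ℕ.≤ k → Removable ρ f If →
      ∃ λ cs → All (InsideFace (inside ρ) f) cs × GoodChain G (faceSet G f) cs S
    remove k bound r = continue k (ℕ.<-≤-trans smaller bound)
      where
      open Removable r
      ρ′ = removeFace ρ t t-inside
      smaller : count (inside ρ′) ℕ.< count (inside ρ)
      smaller = count-< (inside ρ′) (inside ρ) (removeFace-⊆ ρ t t-inside) t
        (cong₂ _xor_ t-inside (face-self t)) t-inside
      f-inside′ : inside ρ′ f ≡ true
      f-inside′ = cong₂ _xor_ If (≢true⇒false (t-other ∘ SameFace-sym ∘ face⇒SameFace))
      continue : ∀ k → count (inside ρ′) ℕ.< k →
        ∃ λ cs → All (InsideFace (inside ρ) f) cs × GoodChain G (faceSet G f) cs S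
      continue (suc k) (s≤s bound′) =
        let (cs , all , chain) = shelling k removed ρ′ f f-inside′ bound′ in
        cs ++ faceSet G t ∷ [] ,
        All.++⁺ (All.map (λ (x , Ix , rest) → x , removeFace-⊆ ρ t t-inside x Ix , rest) all)
                ((t , t-inside , t-other , λ y → refl) ∷ []) ,
        GoodChain-snoc cs chain
          (λ y → trans (cong ((S y xor edgeSum (triangle t) y) xor_) (faceSet-sum t y)) (xor-cancelʳ (S y) _))
          (CycleList⇒IsCycle CL)

  -- Spanning by the modified set of faces

  face-isCycle : ∀ t → IsCycle G (faceSet G t)
  face-isCycle t = CycleList⇒IsCycle (record { cyc = triangle-cyc t ; sums = faceSet-sum t })

  inside⇒Internal : ∀ {S} (ρ : Region S) {x} → inside ρ x ≡ true → Internal G x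
  inside⇒Internal ρ Ix same = true≢false Ix (trans (SameFace-inv (inside-φ ρ) same) (inside-outer ρ))

  -- Otherwise the three distinct darts of the triangle would all be among the two darts `y` and
  -- `α y`.
  oneCommonEdge⇒¬SameFace : ∀ {a b} → ExactlyOneCommonEdge G a b → ¬ SameFace G a b
  oneCommonEdge⇒¬SameFace {a} {b} (y , _ , _ , only) same =
    three (both (here refl)) (both (there (here refl))) (both (there (there (here refl))))
    where
    both : ∀ {z} → z ∈ triangle a → z ≡ y ⊎ z ≡ α y
    both {z} z∈ = only z (trans (faceSet-sum a z) on)
      (trans (faceSet-sum b z) (trans (sym (triangle-SameFace same z)) on))
      where on = edgeSum-∈ (triangle-cyc a) z∈
    a≢φa = φ-nofix a ∘ sym
    φa≢φφa = φ-nofix (φ a) ∘ sym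
    a≢φφa = φ²-nofix φ φ-tri φ-nofix a ∘ sym
    three : a ≡ y ⊎ a ≡ α y → φ a ≡ y ⊎ φ a ≡ α y → φ (φ a) ≡ y ⊎ φ (φ a) ≡ α y → ⊥
    three (inj₁ p) (inj₁ q) _ = a≢φa (trans p (sym q))
    three (inj₂ p) (inj₂ q) _ = a≢φa (trans p (sym q))
    three (inj₁ p) (inj₂ q) (inj₁ r) = a≢φφa (trans p (sym r))
    three (inj₂ p) (inj₁ q) (inj₂ r) = a≢φφa (trans p (sym r))
    three (inj₁ p) (inj₂ q) (inj₂ r) = φa≢φφa (trans q (sym r))
    three (inj₂ p) (inj₁ q) (inj₁ r) = φa≢φφa (trans q (sym r))

  Spanned : Dart → Dart → EdgeSet G → Set
  Spanned a b σ = Σ (EdgeSet G) λ α₁ → Σ (List (EdgeSet G)) λ rest →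
    ReplacedFaces G a b α₁ × All (ReplacedFaces G a b) rest × GoodChain G α₁ rest σ

  -- The cycle a itself is reached as (a Δ b) Δ b; the shelling then never needs it again.
  spanned-inside : ∀ {a b} → Internal G b → ¬ SameFace G a b →
    ∀ {S L} → CycleList S L → (ρ : Region S) → inside ρ a ≡ true → Spanned a b S
  spanned-inside {a} {b} b-internal a≁b CL ρ Ia =
    let (cs , all , chain) = shelling _ CL ρ a Ia ℕ.≤-refl in
    -- If `b` lies in the region, it occurs in `cs` once more; a chain may use a face repeatedly.
    (λ y → faceSet G a y xor faceSet G b y) , faceSet G b ∷ cs ,
    inj₁ (λ y → refl) ,
    inj₂ (b , b-internal , a≁b , λ y → refl) ∷
      All.map (λ (x , Ix , a≁x , eq) → inj₂ (x , inside⇒Internal ρ Ix , a≁x , eq)) all ,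
    IsCycle-resp a≡ (face-isCycle a) , GoodChain-resp cs a≡ chain
    where
    a≡ : ∀ y → faceSet G a y ≡ (faceSet G a y xor faceSet G b y) xor faceSet G b y
    a≡ y = sym (xor-cancelʳ (faceSet G a y) (faceSet G b y))

  spanned-outside : ∀ {a b S L} → CycleList S L → (ρ : Region S) → inside ρ a ≡ false →
    ∀ f → inside ρ f ≡ true → Spanned a b S
  spanned-outside {a} CL ρ Ia f If =
    let (cs , all , chain) = shelling _ CL ρ f If ℕ.≤-refl in
    faceSet G f , cs , inj₂ (f , inside⇒Internal ρ If , a≁ If , λ y → refl) ,
    All.map (λ (x , Ix , _ , eq) → inj₂ (x , inside⇒Internal ρ Ix , a≁ Ix , eq)) all , chain
    where
    a≁ : ∀ {x} → inside ρ x ≡ true → ¬ SameFace G a x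
    a≁ Ix same = true≢false Ix (trans (SameFace-inv (inside-φ ρ) same) Ia)

  spanned : ∀ {a b} → Internal G b → ¬ SameFace G a b →
    ∀ {S L} → CycleList S L → Region S → Spanned a b S
  spanned b-internal a≁b {L = []} CL ρ with () ← long (cyc CL)
  spanned {a} b-internal a≁b {S} {L = x ∷ L} CL ρ = by-side (inside ρ a) refl
    where
    by-side : ∀ i → inside ρ a ≡ i → Spanned a _ S
    by-side true Ia = spanned-inside b-internal a≁b CL ρ Ia
    -- An edge of the cycle has a side in the region, which supplies the face to start from.
    by-side false Ia with xor-true⇒ (inside ρ x)
      (trans (boundary ρ x) (trans (sums CL x) (edgeSum-∈ (cyc CL) (here refl))))
    ... | inj₁ Ix = spanned-outside CL ρ Ia x Ix
    ... | inj₂ Iαx = spanned-outside CL ρ Ia (α x) Iαx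

  region-of : ∀ {S L} → CycleList S L → Region S
  region-of CL = record
    { inside = inside ρ ; inside-φ = inside-φ ρ ; inside-outer = inside-outer ρ
    ; boundary = λ y → trans (boundary ρ y) (sym (sums CL y)) }
    where ρ = jordan (path (cyc CL))

open TriangulatedPlaneGraph using (d)

theorem4 : (G : TriangulatedPlaneGraph) (a b : Fin (d G)) →
    Internal G a → Internal G b → ExactlyOneCommonEdge G a b →
    CyclicallySpans G (ReplacedFaces G a b)
theorem4 G a b _ b-internal one σ σ-cycle =
  let (L , CL) = IsCycle⇒CycleList σ-cycle in
  spanned b-internal (oneCommonEdge⇒¬SameFace one) CL (region-of CL)
  where open Plane G
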